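{- For every integer $n\geq 2$, $$n!\leq \operatorname{GM}_3(P_5:nK_2)=\operatorname{M}_3(nK_2)\leq \frac{(2n)!}{2^{n}\,n!}.$$
   Context: All graphs are finite, simple and undirected; colorings are edge-colorings. $P_5$ is the path on $5$ vertices; $nK_2$ is a matching with $n$ edges. A $k$-coloring is exact if all $k$ colors are used at least once. A colored graph is rainbow if no two of its edges have the same color, and monochromatic if all its edges have the same color. Copies of a graph are counted as (not necessarily induced) subgraphs. The Gallai-Ramsey number $\operatorname{gr}_k(G:H)$ is the minimum integer $m$ with $\binom{m}{2}\geq k$ such that for every $N\geq m$, every exact $k$-coloring of $K_N$ contains a rainbow copy of $G$ or a monochromatic copy of $H$. The Gallai-Ramsey multiplicity $\operatorname{GM}_k(G:H)$ (also written $\operatorname{GM}_k(G,H)$) is the minimum, over all exact $k$-colorings of $K_{\operatorname{gr}_k(G:H)}$, of the total number of rainbow copies of $G$ and monochromatic copies of $H$. The Ramsey number $\operatorname{r}_k(H)$ is the least $r$ such that every $k$-coloring (not necessarily exact) of $K_r$ contains a monochromatic copy of $H$, and the Ramsey multiplicity $\operatorname{M}_k(H)$ is the minimum number of monochromatic copies of $H$ over all $k$-colorings of $K_{\operatorname{r}_k(H)}$. -}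

module Defs where

open import Data.Fin using (Fin; toℕ; quotient; _<_)
open import Data.Fin.Properties using (_≟_)
open import Data.Fin.Subset using (Subset; _∈_)
open import Data.List using (length)
import Data.List.Membership.Propositional as List
open import Data.List.Relation.Unary.Unique.Propositional using (Unique)
open import Data.Nat using (ℕ; suc; _+_; _*_; _^_; _!; _≤_; NonZero)
import Data.Nat.Properties as ℕ
open import Data.Nat.Combinatorics using (_C_)
open import Data.Product using (Σ; ∃; ∃₂; _×_; _,_)
open import Data.Sum using (_⊎_; inj₁; inj₂; swap)
open import Data.Vec using (Vec; lookup)
open import Function.Bundles using (_⇔_)
open import Function.Definitions using (Injective; Surjective)
open import Level using (0ℓ)
open import Relation.Binary.Core using (Rel)
open import Relation.Binary.Definitions using (Decidable; Symmetric; Irreflexive)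
open import Relation.Binary.PropositionalEquality using (_≡_; _≢_; refl; sym)
open import Relation.Nullary.Decidable using (_×-dec_; _⊎-dec_; ¬?)

record Graph : Set₁ where
  field
    order      : ℕ
    Adj        : Rel (Fin order) 0ℓ
    adj?       : Decidable Adj
    adj-sym    : Symmetric Adj
    adj-irrefl : Irreflexive _≡_ Adj

path : ℕ → Graph
path n = record
  { order      = n
  ; Adj        = λ i j → suc (toℕ i) ≡ toℕ j ⊎ suc (toℕ j) ≡ toℕ i
  ; adj?       = λ i j → (suc (toℕ i) ℕ.≟ toℕ j) ⊎-dec (suc (toℕ j) ℕ.≟ toℕ i)
  ; adj-sym    = swap
  ; adj-irrefl = λ { refl (inj₁ p) → ℕ.1+n≢n p ; refl (inj₂ p) → ℕ.1+n≢n p }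
  }

P₅ : Graph
P₅ = path 5

-- The vertices are split into n consecutive blocks of size 2, each block
-- spanning an edge.
_K₂ : ℕ → Graph
n K₂ = record
  { order      = n * 2
  ; Adj        = λ i j → i ≢ j × quotient {n} 2 i ≡ quotient {n} 2 j
  ; adj?       = λ i j → ¬? (i ≟ j) ×-dec (quotient {n} 2 i ≟ quotient {n} 2 j)
  ; adj-sym    = λ { (i≢j , q) → (λ j≡i → i≢j (sym j≡i)) , sym q }
  ; adj-irrefl = λ { i≡j (i≢j , _) → i≢j i≡j }
  }

-- An edge {lo , hi} of the complete graph K_N on Fin N.
record Edge (N : ℕ) : Set where
  constructor edge
  field
    lo hi : Fin N
    lo<hi : lo < hi

Coloring : ℕ → ℕ → Set
Coloring k N = Edge N → Fin k

Exact : ∀ {k N} → Coloring k N → Set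
Exact c = Surjective _≡_ _≡_ c

-- A vertex set together with a neighbourhood for each vertex of K_N, given by
-- bit vectors so that propositional equality is equality of the vertex sets
-- and of the edge sets.
record SubgraphData (N : ℕ) : Set where
  constructor subgraph
  field
    verts : Subset N
    nbhd  : Vec (Subset N) N

  _~_ : Rel (Fin N) 0ℓ
  u ~ v = v ∈ lookup nbhd u

open SubgraphData public using (verts)

record IsSubgraph {N} (S : SubgraphData N) : Set where
  open SubgraphData S using (_~_)
  field
    ~-sym      : Symmetric _~_
    ~-irrefl   : Irreflexive _≡_ _~_
    ~-incident : ∀ {u v} → u ~ v → u ∈ verts S

_∈E_ : ∀ {N} → Edge N → SubgraphData N → Set
e ∈E S = lo ~ hi
  where
  open Edge e
  open SubgraphData S

record IsCopy (G : Graph) {N} (S : SubgraphData N) : Set where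
  open Graph G
  open SubgraphData S using (_~_)
  field
    isSubgraph  : IsSubgraph S
    φ           : Fin order → Fin N
    φ-injective : Injective _≡_ _≡_ φ
    φ-image     : ∀ v → v ∈ verts S ⇔ (∃ λ i → φ i ≡ v)
    φ-adj       : ∀ i j → Adj i j ⇔ (φ i ~ φ j)

Rainbow : ∀ {k N} → Coloring k N → SubgraphData N → Set
Rainbow c S = ∀ e f → e ∈E S → f ∈E S → c e ≡ c f → e ≡ f

Monochromatic : ∀ {k N} → Coloring k N → SubgraphData N → Set
Monochromatic c S = ∀ e f → e ∈E S → f ∈E S → c e ≡ c f

RainbowCopy : ∀ {k N} → Coloring k N → Graph → SubgraphData N → Set
RainbowCopy c G S = IsCopy G S × Rainbow c S

MonoCopy : ∀ {k N} → Coloring k N → Graph → SubgraphData N → Set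
MonoCopy c H S = IsCopy H S × Monochromatic c S

HasCardinality : {A : Set} → (A → Set) → ℕ → Set
HasCardinality P t =
  ∃ λ xs → Unique xs × (∀ x → x List.∈ xs ⇔ P x) × length xs ≡ t

IsMinimum : (ℕ → Set) → ℕ → Set
IsMinimum P m = P m × (∀ m′ → P m′ → m ≤ m′)

-- The four graph parameters below are given as relations "the parameter has
-- value m"; the value is unique by antisymmetry of ≤.

IsGallaiRamseyNumber : ℕ → Graph → Graph → ℕ → Set
IsGallaiRamseyNumber k G H = IsMinimum λ m →
  k ≤ m C 2 ×
  (∀ N → m ≤ N → (c : Coloring k N) → Exact c →
    ∃ (RainbowCopy c G) ⊎ ∃ (MonoCopy c H))

IsGallaiRamseyMultiplicity : ℕ → Graph → Graph → ℕ → Set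
IsGallaiRamseyMultiplicity k G H m =
  ∃ λ N → IsGallaiRamseyNumber k G H N ×
  IsMinimum
    (λ t → Σ (Coloring k N) λ c → Exact c ×
      ∃₂ λ a b → HasCardinality (RainbowCopy c G) a ×
                 HasCardinality (MonoCopy c H) b × t ≡ a + b)
    m

IsRamseyNumber : ℕ → Graph → ℕ → Set
IsRamseyNumber k H = IsMinimum λ r → (c : Coloring k r) → ∃ (MonoCopy c H)

IsRamseyMultiplicity : ℕ → Graph → ℕ → Set
IsRamseyMultiplicity k H m =
  ∃ λ N → IsRamseyNumber k H N ×
  IsMinimum
    (λ t → Σ (Coloring k N) λ c → HasCardinality (MonoCopy c H) t)
    m

2^n*n!≢0 : ∀ n → NonZero (2 ^ n * n !)
2^n*n!≢0 n = ℕ.m*n≢0 (2 ^ n) (n !) {{ℕ.m^n≢0 2 n}} {{n ℕ.!≢0}}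

{-# OPTIONS --safe #-}

-- A rainbow P₅ has four colours, so only monochromatic copies matter, and gr₃ = r₃ = 4n - 2.
--
-- Lower bound n!, by induction on n, for any vertex set of size at least 4n - 2. Suppose there are
-- n sets T of at most four vertices, each containing an edge of every colour, such that for each
-- colour the chosen edges of any two of the sets differ and one of them meets the other set. Then
-- the (n - 1)! monochromatic matchings avoiding each T extend to n! distinct matchings. If every
-- vertex has degree at least 2n - 1 in some colour, then n vertices share that colour and can be
-- matched greedily, in n! ways, to vertices outside. Otherwise some vertex x has degree at least n
-- in two colours j and k. If all degrees in the third colour i are less than n, colour i can be
-- ignored altogether and triples {x , b , c} do. If not, let y have degree at least n in colour i:
-- use the stars {x , a , b , c} for the i-neighbours a of x, and the sets {x , y , w , z} for the
-- i-neighbours w of y that are not i-neighbours of x, where xw and xz have colours j and k.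
--
-- Upper bound: give the edge uv with u < v the colour 0, 1 or 2 according to the position of v in
-- consecutive intervals of lengths 2n, n - 1 and n - 1. Then the monochromatic copies are perfect
-- matchings of the first interval. With 2n - 1 in place of 2n there are no copies at all.
--
-- An optimal colouring can be made exact by recolouring single edges, which creates no new copies.
module Submission where

open import Defs
import Data.Bool.Properties as Bool
open import Data.Fin
  using (Fin; zero; suc; toℕ; quotient; remainder; combine; funToFin; finToFun; punchOut; inject₁)
open import Data.Fin.Patterns using (0F; 1F; 2F)
import Data.Fin.Properties as Fin
open import Data.Fin.Subset using () renaming (_∈_ to _∈ˢ_)
import Data.Fin.Subset.Properties as Subset
open import Data.List
  using ( List; []; _∷_; _++_; length; filter; map; take; tabulate; lookup; allFin; applyUpTo
        ; cartesianProduct; cartesianProductWith; concatMap; deduplicate)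
open import Data.List.Properties
  using (length-map; length-++; length-take; length-tabulate; length-applyUpTo; filter-notAll; tabulate-lookup)
open import Data.List.Membership.Propositional using (_∈_; _∉_; find; lose)
open import Data.List.Membership.Propositional.Properties
  using ( ∈-++⁺ˡ; ∈-++⁺ʳ; ∈-++⁻; ∈-∃++; ∈-map⁺; ∈-map⁻; ∈-filter⁺; ∈-filter⁻; ∈-lookup
        ; ∈-tabulate⁺; ∈-tabulate⁻; ∈-allFin; ∈-applyUpTo⁺; ∈-concatMap⁺
        ; ∈-cartesianProduct⁺; ∈-cartesianProductWith⁺; ∈-deduplicate⁺; ∈-deduplicate⁻)
open import Data.List.Relation.Binary.Permutation.Propositional
  using (_↭_; ↭-refl; ↭-sym; ↭-trans; prep; swap; ↭⇒↭ₛ)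
open import Data.List.Relation.Binary.Permutation.Propositional.Properties using (∈-resp-↭)
import Data.List.Relation.Binary.Permutation.Setoid.Properties as Permutation
open import Data.List.Relation.Unary.All as All using (All; []; _∷_)
import Data.List.Relation.Unary.All.Properties as All
open import Data.List.Relation.Unary.AllPairs as AllPairs using (AllPairs; []; _∷_)
import Data.List.Relation.Unary.AllPairs.Properties as AllPairs
open import Data.List.Relation.Unary.Any as Any using (here; there)
open import Data.List.Relation.Unary.Unique.Propositional using (Unique)
import Data.List.Relation.Unary.Unique.Propositional.Properties as Unique
open import Data.Nat
open import Data.Nat.Combinatorics using (nC1≡n; nCk+nC[k+1]≡[n+1]C[k+1]) renaming (_C_ to _choose_)
open import Data.Nat.DivMod using (m*n/n≡m)
open import Data.Nat.Properties
open import Data.Nat.Tactic.RingSolver using (solve-∀)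
open import Data.Product using (Σ; ∃; ∃₂; _×_; _,_; proj₁; proj₂; uncurry)
import Data.Product.Properties as Product
open import Data.Sum as Sum using (_⊎_; inj₁; inj₂; [_,_]′)
import Data.Vec as Vec
import Data.Vec.Properties as Vec
open import Function using (_∘_; id; case_of_)
open import Function.Bundles using (_⇔_; mk⇔; Equivalence)
open import Function.Definitions using (Injective)
open import Relation.Binary.Definitions using (DecidableEquality; tri<; tri≈; tri>)
open import Relation.Binary.PropositionalEquality
open import Relation.Nullary using (¬_; Dec; yes; no; does; contradiction)
open import Relation.Nullary.Decidable using (¬?; _×-dec_; _⊎-dec_; dec-true; map′)

-- Families of monochromatic matchings

module _ {A : Set} where

  Unique-⊆⇒length≤ : ∀ {xs ys : List A} → Unique xs → (∀ {v} → v ∈ xs → v ∈ ys) →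
                     length xs ≤ length ys
  Unique-⊆⇒length≤ {[]} [] xs⊆ys = z≤n
  Unique-⊆⇒length≤ {x ∷ xs} (x∉xs ∷ xs!) xs⊆ys with ∈-∃++ (xs⊆ys (here refl))
  ... | us , vs , refl = begin
    suc (length xs)              ≤⟨ s≤s (Unique-⊆⇒length≤ xs! xs⊆us++vs) ⟩
    suc (length (us ++ vs))      ≡⟨ cong suc (length-++ us) ⟩
    suc (length us + length vs)  ≡⟨ +-suc (length us) (length vs) ⟨
    length us + suc (length vs)  ≡⟨ length-++ us ⟨
    length (us ++ x ∷ vs)        ∎
    where
    open ≤-Reasoning
    xs⊆us++vs : ∀ {v} → v ∈ xs → v ∈ us ++ vs
    xs⊆us++vs v∈xs with ∈-++⁻ us (xs⊆ys (there v∈xs))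
    ... | inj₁ v∈us = ∈-++⁺ˡ v∈us
    ... | inj₂ (here refl) = contradiction refl (All.lookup x∉xs v∈xs)
    ... | inj₂ (there v∈vs) = ∈-++⁺ʳ us v∈vs

  ∈-mid : ∀ xs {ys} {v z : A} → v ∈ xs ++ ys → v ∈ xs ++ z ∷ ys
  ∈-mid [] v∈ = there v∈
  ∈-mid (x ∷ xs) (here p) = here p
  ∈-mid (x ∷ xs) (there v∈) = there (∈-mid xs v∈)

  Unique-mid : ∀ xs {z} {ys : List A} → Unique (xs ++ z ∷ ys) →
               All (z ≢_) (xs ++ ys) × Unique (xs ++ ys)
  Unique-mid [] (z∉ ∷ ys!) = z∉ , ys!
  Unique-mid (x ∷ xs) (x∉ ∷ xs!) with Unique-mid xs xs!
  ... | z∉ , xs++ys! =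
    (λ z≡x → All.lookup x∉ (∈-++⁺ʳ xs (here refl)) (sym z≡x)) ∷ z∉ ,
    All.tabulate (λ v∈ → All.lookup x∉ (∈-mid xs v∈)) ∷ xs++ys!

  AllPairs-All : ∀ {P : A → Set} {R : A → A → Set} {xs} → All P xs → AllPairs R xs →
                 AllPairs (λ x y → P x × P y × R x y) xs
  AllPairs-All [] [] = []
  AllPairs-All (p ∷ ps) (r ∷ rs) =
    All.zipWith (λ (q , r) → p , q , r) (ps , r) ∷ AllPairs-All ps rs

  ∈-take : ∀ {v : A} n {xs} → v ∈ take n xs → v ∈ xs
  ∈-take (suc n) {_ ∷ _} (here p) = here p
  ∈-take (suc n) {_ ∷ _} (there p) = there (∈-take n p)

  length-take-≤ : ∀ {n} (xs : List A) → n ≤ length xs → length (take n xs) ≡ n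
  length-take-≤ {n} xs n≤ = trans (length-take n xs) (m≤n⇒m⊓n≡m n≤)

module _ {A B : Set} {P : A → Set} (f : ∀ {x} → P x → B) where

  length-reduce : ∀ {xs} (ps : All P xs) → length (All.reduce f ps) ≡ length xs
  length-reduce [] = refl
  length-reduce (p ∷ ps) = cong suc (length-reduce ps)

  ∈-reduce⁻ : ∀ {xs y} {ps : All P xs} → y ∈ All.reduce f ps → ∃₂ λ x (p : P x) → x ∈ xs × y ≡ f p
  ∈-reduce⁻ {ps = p ∷ ps} (here refl) = _ , p , here refl , refl
  ∈-reduce⁻ {ps = p ∷ ps} (there y∈) with ∈-reduce⁻ y∈
  ... | x , q , x∈ , eq = x , q , there x∈ , eq

  reduce-pairs : ∀ {S : A → A → Set} {R : B → B → Set} →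
                 (∀ {x y} (p : P x) (q : P y) → S x y → R (f p) (f q)) →
                 ∀ {xs} → AllPairs S xs → (ps : All P xs) → AllPairs R (All.reduce f ps)
  reduce-pairs S⇒R [] [] = []
  reduce-pairs {S} {R} S⇒R {x ∷ _} (s ∷ ss) (p ∷ ps) = go s ps ∷ reduce-pairs S⇒R ss ps
    where
    go : ∀ {ys} → All (S x) ys → (qs : All P ys) → All (R (f p)) (All.reduce f qs)
    go [] [] = []
    go (s ∷ ss) (q ∷ qs) = S⇒R p q s ∷ go ss qs

module _ {N : ℕ} where
  open import Data.List.Membership.DecPropositional (Fin._≟_ {N}) using (_∈?_)

  infixl 5 _∖_
  _∖_ : List (Fin N) → List (Fin N) → List (Fin N)
  xs ∖ ys = filter (λ v → ¬? (v ∈? ys)) xs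

  ∈-∖⁺ : ∀ {v xs ys} → v ∈ xs → v ∉ ys → v ∈ xs ∖ ys
  ∈-∖⁺ = ∈-filter⁺ (λ v → ¬? (v ∈? _))

  ∈-∖⁻ : ∀ {v} xs ys → v ∈ xs ∖ ys → v ∈ xs × v ∉ ys
  ∈-∖⁻ xs ys = ∈-filter⁻ (λ v → ¬? (v ∈? ys)) {xs = xs}

  ∖-unique : ∀ {xs} ys → Unique xs → Unique (xs ∖ ys)
  ∖-unique ys = Unique.filter⁺ (λ v → ¬? (v ∈? ys))

  length≤∖+ : ∀ {xs} ys → Unique xs → length xs ≤ length (xs ∖ ys) + length ys
  length≤∖+ {xs} ys xs! = subst (length xs ≤_) (length-++ (xs ∖ ys)) (Unique-⊆⇒length≤ xs! split)
    where
    split : ∀ {v} → v ∈ xs → v ∈ (xs ∖ ys) ++ ys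
    split {v} v∈xs with v ∈? ys
    ... | yes v∈ys = ∈-++⁺ʳ (xs ∖ ys) v∈ys
    ... | no v∉ys = ∈-++⁺ˡ (∈-∖⁺ v∈xs v∉ys)

  length-∖-self : ∀ {y ys} → y ∈ ys → suc (length (ys ∖ (y ∷ []))) ≤ length ys
  length-∖-self {y} {ys} y∈ys =
    filter-notAll (λ v → ¬? (v ∈? (y ∷ []))) ys (Any.map (λ { refl v∉ → v∉ (here refl) }) y∈ys)

-- An edge is stored as an ordered pair and the edges come in a list; `SameEdges` forgets both
-- orders. Disjointness of the edges is expressed by `Unique (ends M)`.
Matching : ℕ → Set
Matching N = List (Fin N × Fin N)

ends : ∀ {N} → Matching N → List (Fin N)
ends [] = []
ends ((u , v) ∷ M) = u ∷ v ∷ ends M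

Joins : ∀ {N} → Matching N → Fin N → Fin N → Set
Joins M u v = (u , v) ∈ M ⊎ (v , u) ∈ M

SameEdges : ∀ {N} → Matching N → Matching N → Set
SameEdges M M′ = (∀ {u v} → Joins M u v → Joins M′ u v) × (∀ {u v} → Joins M′ u v → Joins M u v)

∈⇒ends : ∀ {N} {M : Matching N} {u v} → (u , v) ∈ M → u ∈ ends M × v ∈ ends M
∈⇒ends (here refl) = here refl , there (here refl)
∈⇒ends (there e∈M) with ∈⇒ends e∈M
... | u∈ , v∈ = there (there u∈) , there (there v∈)

Joins⇒ends : ∀ {N} {M : Matching N} {u v} → Joins M u v → u ∈ ends M × v ∈ ends M
Joins⇒ends (inj₁ e∈M) = ∈⇒ends e∈M
Joins⇒ends (inj₂ e∈M) with ∈⇒ends e∈M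
... | v∈ , u∈ = u∈ , v∈

Joins-∷⁺ : ∀ {N} {M : Matching N} {e u v} → Joins M u v → Joins (e ∷ M) u v
Joins-∷⁺ (inj₁ p) = inj₁ (there p)
Joins-∷⁺ (inj₂ p) = inj₂ (there p)

_≈ᵉ_ : ∀ {N} → Fin N × Fin N → Fin N × Fin N → Set
(u , v) ≈ᵉ (u′ , v′) = (u ≡ u′ × v ≡ v′) ⊎ (u ≡ v′ × v ≡ u′)

≈ᵉ-trans : ∀ {N} {e f g : Fin N × Fin N} → e ≈ᵉ f → f ≈ᵉ g → e ≈ᵉ g
≈ᵉ-trans (inj₁ (refl , refl)) f≈g = f≈g
≈ᵉ-trans (inj₂ (refl , refl)) (inj₁ (refl , refl)) = inj₂ (refl , refl)
≈ᵉ-trans (inj₂ (refl , refl)) (inj₂ (refl , refl)) = inj₁ (refl , refl)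

≈ᵉ-sym : ∀ {N} {e f : Fin N × Fin N} → e ≈ᵉ f → f ≈ᵉ e
≈ᵉ-sym (inj₁ (p , q)) = inj₁ (sym p , sym q)
≈ᵉ-sym (inj₂ (p , q)) = inj₂ (sym q , sym p)

Joins-∷⁻ : ∀ {N} {M : Matching N} {e u v} → Joins (e ∷ M) u v → (u , v) ≈ᵉ e ⊎ Joins M u v
Joins-∷⁻ (inj₁ (here refl)) = inj₁ (inj₁ (refl , refl))
Joins-∷⁻ (inj₁ (there p)) = inj₂ (inj₁ p)
Joins-∷⁻ (inj₂ (here refl)) = inj₁ (inj₂ (refl , refl))
Joins-∷⁻ (inj₂ (there p)) = inj₂ (inj₂ p)

Touches : ∀ {N} → Fin N × Fin N → List (Fin N) → Set
Touches (u , v) T = u ∈ T ⊎ v ∈ T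

-- Extending monochromatic matchings by one edge

module Coloured {N : ℕ} (col : Fin N → Fin N → Fin 3) (col-sym : ∀ u v → col u v ≡ col v u) where

  record Mono (i : Fin 3) (V : List (Fin N)) (n : ℕ) (M : Matching N) : Set where
    field
      size   : length M ≡ n
      unique : Unique (ends M)
      within : All (_∈ V) (ends M)
      colour : All (λ e → uncurry col e ≡ i) M

    Joins⇒colour : ∀ {u v} → Joins M u v → col u v ≡ i
    Joins⇒colour (inj₁ e∈M) = All.lookup colour e∈M
    Joins⇒colour {u} {v} (inj₂ e∈M) = trans (col-sym u v) (All.lookup colour e∈M)

  MonoIn : List (Fin 3) → List (Fin N) → ℕ → Matching N → Set
  MonoIn C V n M = ∃ λ i → i ∈ C × Mono i V n M

  -- The palette `C` varies because the induction is also run with only one or two of the colours.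
  -- Members differ as edge sets, so that they yield different copies.
  Family : List (Fin 3) → List (Fin N) → ℕ → Set
  Family C V n = ∃ λ Ms →
    length Ms ≡ n ! × AllPairs (λ M M′ → ¬ SameEdges M M′) Ms × All (MonoIn C V n) Ms

  family-zero : ∀ {i C V} → i ∈ C → Family C V 0
  family-zero i∈C = [] ∷ [] , refl , [] ∷ [] ,
    (_ , i∈C , record { size = refl ; unique = [] ; within = [] ; colour = [] }) ∷ []

  family-mono : ∀ {C C′ V n} → (∀ {i} → i ∈ C → i ∈ C′) → Family C V n → Family C′ V n
  family-mono C⊆C′ (Ms , len , distinct , good) =
    Ms , len , distinct , All.map (λ (i , i∈C , mono) → i , C⊆C′ i∈C , mono) good

  -- This encodes the set T of the outline: `core` is T, and `arm i` is the edge inside T that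
  -- extends a matching of colour `i` avoiding T.
  record Branch (C : List (Fin 3)) (V : List (Fin N)) : Set where
    field
      core     : List (Fin N)
      arm      : Fin 3 → Fin N × Fin N
      core⊆V   : ∀ {v} → v ∈ core → v ∈ V
      arm-col  : ∀ {i} → i ∈ C → uncurry col (arm i) ≡ i
      arm-loop : ∀ {i} → i ∈ C → proj₁ (arm i) ≢ proj₂ (arm i)
      arm-core : ∀ {i} → i ∈ C → proj₁ (arm i) ∈ core × proj₂ (arm i) ∈ core

  open Branch

  -- Suppose `arm B i` meets `core B′`. The only edge meeting `core B′` in a matching of colour `i`
  -- grown from `B′` is `arm B′ i`, so this matching cannot contain `arm B i`, whereas those grown
  -- from `B` do.
  Compatible : ∀ {C V} → Branch C V → Branch C V → Set
  Compatible {C} B B′ = ∀ {i} → i ∈ C →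
    ¬ (arm B i ≈ᵉ arm B′ i) × (Touches (arm B i) (core B′) ⊎ Touches (arm B′ i) (core B))

  module _ {C : List (Fin 3)} {V : List (Fin N)} {n : ℕ} where

    record Grown (B : Branch C V) (i : Fin 3) (P : Matching N) : Set where
      field
        {M}  : Matching N
        i∈C  : i ∈ C
        P≡   : P ≡ arm B i ∷ M
        mono : Mono i (V ∖ core B) n M

      avoids : ∀ {v} → v ∈ ends M → v ∉ core B
      avoids v∈ = proj₂ (∈-∖⁻ V (core B) (All.lookup (Mono.within mono) v∈))

      untouched : ∀ {u v} → Touches (u , v) (core B) → ¬ Joins M u v
      untouched (inj₁ u∈) j = avoids (proj₁ (Joins⇒ends j)) u∈
      untouched (inj₂ v∈) j = avoids (proj₂ (Joins⇒ends j)) v∈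

      off-arm : ∀ {u v} → Joins M u v → ¬ ((u , v) ≈ᵉ arm B i)
      off-arm j (inj₁ (refl , _)) = untouched (inj₁ (proj₁ (arm-core B i∈C))) j
      off-arm j (inj₂ (refl , _)) = untouched (inj₁ (proj₂ (arm-core B i∈C))) j

      arm-joined : uncurry (Joins P) (arm B i)
      arm-joined rewrite P≡ = inj₁ (here refl)

      arm-only : ∀ {e} → ¬ (e ≈ᵉ arm B i) → Touches e (core B) → ¬ uncurry (Joins P) e
      arm-only e≉ t j rewrite P≡ with Joins-∷⁻ j
      ... | inj₁ e≈ = e≉ e≈
      ... | inj₂ j′ = untouched t j′

      grown-mono : Mono i V (suc n) P
      grown-mono rewrite P≡ = record
        { size = cong suc (Mono.size mono)
        ; unique = (arm-loop B i∈C ∷ fresh (proj₁ (arm-core B i∈C)))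
                   ∷ fresh (proj₂ (arm-core B i∈C))
                   ∷ Mono.unique mono
        ; within = core⊆V B (proj₁ (arm-core B i∈C)) ∷ core⊆V B (proj₂ (arm-core B i∈C))
                   ∷ All.map (λ v∈ → proj₁ (∈-∖⁻ V (core B) v∈)) (Mono.within mono)
        ; colour = arm-col B i∈C ∷ Mono.colour mono
        }
        where
        fresh : ∀ {w} → w ∈ core B → All (w ≢_) (ends M)
        fresh w∈ = All.tabulate λ v∈ → λ { refl → avoids v∈ w∈ }

    open Grown

    sameColour : ∀ {i i′ P P′} → Mono i V (suc n) P → Mono i′ V (suc n) P′ → SameEdges P P′ → i ≡ i′
    sameColour {P = _ ∷ _} m m′ (to , _) =
      trans (sym (Mono.Joins⇒colour m j)) (Mono.Joins⇒colour m′ (to j))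
      where j = inj₁ (here refl)
    sameColour {P = []} m = contradiction (Mono.size m) λ ()

    compatible⇒distinct : ∀ {B B′ i i′ P P′} → Compatible B B′ →
                          Grown B i P → Grown B′ i′ P′ → ¬ SameEdges P P′
    compatible⇒distinct compat g g′ same@(to , from)
      with refl ← sameColour (grown-mono g) (grown-mono g′) same
      with compat (i∈C g)
    ... | e≉e′ , inj₁ t = arm-only g′ e≉e′ t (to (arm-joined g))
    ... | e≉e′ , inj₂ t = arm-only g (e≉e′ ∘ ≈ᵉ-sym) t (from (arm-joined g′))

    -- Once the colours agree, both matchings contain the same arm. It lies in `core B`, which the
    -- remaining edges avoid, so it can be cancelled.
    distinct⇒distinct : ∀ {B i i′ P P′} (g : Grown B i P) (g′ : Grown B i′ P′) →
                        ¬ SameEdges (M g) (M g′) → ¬ SameEdges P P′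
    distinct⇒distinct {B} g g′ M≄M′ same@(to , from)
      with refl ← sameColour (grown-mono g) (grown-mono g′) same
      = M≄M′ (strip g g′ to , strip g′ g from)
      where
      strip : ∀ {i P P′} (g : Grown B i P) (g′ : Grown B i P′) →
              (∀ {u v} → Joins P u v → Joins P′ u v) → ∀ {u v} → Joins (M g) u v → Joins (M g′) u v
      strip {P = P} {P′} g g′ to {u} {v} j with Joins-∷⁻ {M = M g′} {e = arm B _} joined
        where
        joined : Joins (arm B _ ∷ M g′) u v
        joined = subst (λ Q → Joins Q u v) (P≡ g′)
          (to (subst (λ Q → Joins Q u v) (sym (P≡ g)) (Joins-∷⁺ {e = arm B _} j)))
      ... | inj₁ e≈ = contradiction e≈ (off-arm g j)
      ... | inj₂ j′ = j′

    GrownFrom : Branch C V → Matching N → Set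
    GrownFrom B P = ∃ λ i → Grown B i P

    grow : (B : Branch C V) → (F : Family C (V ∖ core B) n) →
           ∃ λ Ps → length Ps ≡ n ! × AllPairs (λ P P′ → ¬ SameEdges P P′) Ps × All (GrownFrom B) Ps
    grow B (Ms , len , distinct , good) with go distinct good
      where
      go : ∀ {Ms} → AllPairs (λ M M′ → ¬ SameEdges M M′) Ms → All (MonoIn C (V ∖ core B) n) Ms →
           ∃ λ Ps → length Ps ≡ length Ms × AllPairs (λ P P′ → ¬ SameEdges P P′) Ps
             × All (λ P → ∃₂ λ i (g : Grown B i P) → M g ∈ Ms) Ps
      go [] [] = [] , refl , [] , []
      go (d ∷ ds) ((i , i∈C , mono) ∷ ms) with go ds ms
      ... | Ps , len , ds′ , gs = _ ∷ Ps , cong suc len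
          , All.map (λ (_ , g′ , M∈) → distinct⇒distinct g g′ (All.lookup d M∈)) gs ∷ ds′
          , (i , g , here refl) ∷ All.map (λ (i , g , M∈) → i , g , there M∈) gs
        where
        g : Grown B i _
        g = record { i∈C = i∈C ; P≡ = refl ; mono = mono }
    ... | Ps , len′ , ds , gs = Ps , trans len′ len , ds , All.map (λ (i , g , _) → i , g) gs

    -- Each of the n + 1 branches contributes n! matchings. Two from one branch differ by
    -- `distinct⇒distinct`, two from different branches by `compatible⇒distinct`.
    branching : (Bs : List (Branch C V)) → length Bs ≡ suc n → AllPairs Compatible Bs →
                (∀ B → B ∈ Bs → Family C (V ∖ core B) n) → Family C V (suc n)
    branching Bs lenBs compat F with go Bs compat F
      where
      go : (Bs : List (Branch C V)) → AllPairs Compatible Bs →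
           (∀ B → B ∈ Bs → Family C (V ∖ core B) n) →
           ∃ λ Ps → length Ps ≡ length Bs * n ! × AllPairs (λ P P′ → ¬ SameEdges P P′) Ps
             × All (λ P → ∃ λ B → B ∈ Bs × GrownFrom B P) Ps
      go [] [] F = [] , refl , [] , []
      go (B ∷ Bs) (c ∷ compat) F
        with grow B (F B (here refl)) | go Bs compat (λ B B∈ → F B (there B∈))
      ... | Ps , len , ds , gs | Ps′ , len′ , ds′ , gs′ =
          Ps ++ Ps′
        , trans (length-++ Ps) (cong₂ _+_ len len′)
        , AllPairs.++⁺ ds ds′ (All.map (λ (_ , g) → All.map (λ (B′ , B′∈ , _ , g′) →
            compatible⇒distinct (All.lookup c B′∈) g g′) gs′) gs)
        , All.++⁺ (All.map (λ g → B , here refl , g) gs)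
                  (All.map (λ (B′ , B′∈ , g) → B′ , there B′∈ , g) gs′)
    ... | Ps , len , ds , gs = Ps , trans len (cong (_* n !) lenBs) , ds
        , All.map (λ (_ , _ , i , g) → i , i∈C g , grown-mono g) gs

  -- Degrees and greedy matchings

  colours : List (Fin 3)
  colours = 0F ∷ 1F ∷ 2F ∷ []

  ∈-colours : ∀ i → i ∈ colours
  ∈-colours 0F = here refl
  ∈-colours 1F = there (here refl)
  ∈-colours 2F = there (there (here refl))

  nbr? : ∀ i x v → Dec (x ≢ v × col x v ≡ i)
  nbr? i x v = ¬? (x Fin.≟ v) ×-dec (col x v Fin.≟ i)

  nbrs : Fin 3 → Fin N → List (Fin N) → List (Fin N)
  nbrs i x = filter (nbr? i x)

  deg : Fin 3 → Fin N → List (Fin N) → ℕ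
  deg i x V = length (nbrs i x V)

  ∈-nbrs⁺ : ∀ {i x v V} → v ∈ V → x ≢ v → col x v ≡ i → v ∈ nbrs i x V
  ∈-nbrs⁺ v∈V x≢v c = ∈-filter⁺ (nbr? _ _) v∈V (x≢v , c)

  ∈-nbrs⁻ : ∀ {i x v V} → v ∈ nbrs i x V → v ∈ V × x ≢ v × col x v ≡ i
  ∈-nbrs⁻ {i} {x} = ∈-filter⁻ (nbr? i x)

  nbrs-unique : ∀ {V} i x → Unique V → Unique (nbrs i x V)
  nbrs-unique i x = Unique.filter⁺ (nbr? i x)

  deg-∖ : ∀ {V} i x T → Unique V → deg i x (V ∖ T) ≤ deg i x V
  deg-∖ {V} i x T V! = Unique-⊆⇒length≤ (nbrs-unique i x (∖-unique T V!)) sub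
    where
    sub : ∀ {v} → v ∈ nbrs i x (V ∖ T) → v ∈ nbrs i x V
    sub v∈ with ∈-nbrs⁻ v∈
    ... | v∈V∖T , x≢v , c = ∈-nbrs⁺ (proj₁ (∈-∖⁻ V T v∈V∖T)) x≢v c

  Cover : Fin 3 → Fin 3 → Fin 3 → Set
  Cover i j k = ∀ c → c ≡ i ⊎ c ≡ j ⊎ c ≡ k

  degree-sum : ∀ {i j k V} x → Cover i j k → Unique V →
               length V ≤ suc (deg i x V + (deg j x V + deg k x V))
  degree-sum {i} {j} {k} {V} x cover V! =
    subst (λ l → length V ≤ suc l)
      (trans (length-++ (nbrs i x V)) (cong (deg i x V +_) (length-++ (nbrs j x V))))
      (Unique-⊆⇒length≤ V! split)
    where
    split : ∀ {v} → v ∈ V → v ∈ x ∷ nbrs i x V ++ nbrs j x V ++ nbrs k x V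
    split {v} v∈V with x Fin.≟ v | cover (col x v)
    ... | yes refl | _ = here refl
    ... | no x≢v | inj₁ c = there (∈-++⁺ˡ (∈-nbrs⁺ v∈V x≢v c))
    ... | no x≢v | inj₂ (inj₁ c) = there (∈-++⁺ʳ (nbrs i x V) (∈-++⁺ˡ (∈-nbrs⁺ v∈V x≢v c)))
    ... | no x≢v | inj₂ (inj₂ c) =
      there (∈-++⁺ʳ (nbrs i x V) (∈-++⁺ʳ (nbrs j x V) (∈-nbrs⁺ v∈V x≢v c)))

  -- The first vertex `y` of `Y` has at least as many possible partners outside `Y` as `Y` has
  -- elements, and the resulting edges share `y`, so they give compatible branches. Using up a
  -- partner `w` costs each later vertex at most this one neighbour, while the demand also drops by
  -- one.
  greedy : ∀ c (Y V : List (Fin N)) → Unique Y → Unique V → (∀ {y} → y ∈ Y → y ∈ V) →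
           (∀ {y} → y ∈ Y → length Y ≤ length (nbrs c y V ∖ Y)) →
           Family (c ∷ []) V (length Y)
  greedy c [] V Y! V! Y⊆V out = family-zero (here refl)
  greedy c (y ∷ Y) V (y∉Y ∷ Y!) V! Y⊆V out =
    branching (All.reduce branch W-outside)
      (trans (length-reduce branch W-outside) (length-take-≤ outside (out (here refl))))
      (reduce-pairs branch compat (Unique.take⁺ _ outside!) W-outside)
      (λ B B∈ → let _ , w∈ , _ , B≡ = ∈-reduce⁻ branch {ps = W-outside} B∈ in
                subst (λ B → Family (c ∷ []) (V ∖ core B) (length Y)) (sym B≡) (rest w∈))
    where
    outside : List (Fin N)
    outside = nbrs c y V ∖ (y ∷ Y)
    outside! : Unique outside
    outside! = ∖-unique (y ∷ Y) (nbrs-unique c y V!)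
    W-outside : All (_∈ outside) (take (suc (length Y)) outside)
    W-outside = All.tabulate (∈-take (suc (length Y)))
    ∈-outside⁻ : ∀ {w} → w ∈ outside → w ∈ V × y ≢ w × col y w ≡ c × w ∉ y ∷ Y
    ∈-outside⁻ w∈ with ∈-∖⁻ (nbrs c y V) (y ∷ Y) w∈
    ... | w∈nbrs , w∉ with ∈-nbrs⁻ w∈nbrs
    ...   | w∈V , y≢w , cw = w∈V , y≢w , cw , w∉
    branch : ∀ {w} → w ∈ outside → Branch (c ∷ []) V
    branch {w} w∈ with ∈-outside⁻ w∈
    ... | w∈V , y≢w , cw , w∉ = record
      { core = y ∷ w ∷ []
      ; arm = λ _ → y , w
      ; core⊆V = λ { (here refl) → Y⊆V (here refl) ; (there (here refl)) → w∈V }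
      ; arm-col = λ { (here refl) → cw }
      ; arm-loop = λ _ → y≢w
      ; arm-core = λ _ → here refl , there (here refl)
      }
    compat : ∀ {w w′} (p : w ∈ outside) (q : w′ ∈ outside) → w ≢ w′ → Compatible (branch p) (branch q)
    compat p q w≢w′ _ = [ w≢w′ ∘ proj₂ , (λ (_ , w≡y) → proj₁ (proj₂ (∈-outside⁻ p)) (sym w≡y)) ]′
                      , inj₁ (inj₁ (here refl))
    rest : ∀ {w} (w∈ : w ∈ outside) → Family (c ∷ []) (V ∖ (y ∷ w ∷ [])) (length Y)
    rest {w} w∈ with ∈-outside⁻ w∈
    ... | w∈V , y≢w , cw , w∉ = greedy c Y (V ∖ (y ∷ w ∷ [])) Y! (∖-unique (y ∷ w ∷ []) V!)
          (λ y′∈ → survives (Y⊆V (there y′∈)) (λ { refl → All.lookup y∉Y y′∈ refl }) (λ { refl → w∉ (there y′∈) }))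
          (λ {y′} y′∈ → s≤s⁻¹ (≤-trans (out (there y′∈))
            (Unique-⊆⇒length≤ (∖-unique (y ∷ Y) (nbrs-unique c y′ V!)) (sub y′))))
      where
      survives : ∀ {v} → v ∈ V → v ≢ y → v ≢ w → v ∈ V ∖ (y ∷ w ∷ [])
      survives v∈V v≢y v≢w = ∈-∖⁺ v∈V λ { (here v≡y) → v≢y v≡y ; (there (here v≡w)) → v≢w v≡w }
      sub : ∀ y′ {v} → v ∈ nbrs c y′ V ∖ (y ∷ Y) → v ∈ w ∷ (nbrs c y′ (V ∖ (y ∷ w ∷ [])) ∖ Y)
      sub y′ {v} v∈ with v Fin.≟ w | ∈-∖⁻ (nbrs c y′ V) (y ∷ Y) v∈
      ... | yes v≡w | _ = here v≡w
      ... | no v≢w | v∈nbrs , v∉ with ∈-nbrs⁻ v∈nbrs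
      ...   | v∈V , y′≢v , cv =
        there (∈-∖⁺ (∈-nbrs⁺ (survives v∈V (v∉ ∘ here) v≢w) y′≢v cv) (v∉ ∘ there))

  module _ (C : List (Fin 3)) (m : ℕ) (V : List (Fin N)) (V! : Unique V) (3m<V : 3 * m < length V)
           (high : ∀ {x} → x ∈ V → ∃ λ i → i ∈ C × 2 * m < deg i x V) where
    open import Data.List.Membership.DecPropositional (Fin._≟_ {3}) using (_∈?_)

    private
      high? : ∀ i x → Dec (i ∈ C × 2 * m < deg i x V)
      high? i x = (i ∈? C) ×-dec (2 * m <? deg i x V)

      class : Fin 3 → List (Fin N)
      class i = filter (high? i) V

      classified : ∀ {x} → x ∈ V → x ∈ class 0F ++ class 1F ++ class 2F
      classified x∈V with high x∈V
      ... | 0F , h = ∈-++⁺ˡ (∈-filter⁺ (high? 0F) x∈V h)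
      ... | 1F , h = ∈-++⁺ʳ (class 0F) (∈-++⁺ˡ (∈-filter⁺ (high? 1F) x∈V h))
      ... | 2F , h = ∈-++⁺ʳ (class 0F) (∈-++⁺ʳ (class 1F) (∈-filter⁺ (high? 2F) x∈V h))

      -- Of the at least 2m + 1 neighbours of `y`, at most m lie in `Y`: it has m + 1 elements, and
      -- `y` is not its own neighbour.
      outside : ∀ {i Y} → length Y ≡ suc m → (∀ {y} → y ∈ Y → y ∈ class i) →
                ∀ {y} → y ∈ Y → length Y ≤ length (nbrs i y V ∖ Y)
      outside {i} {Y} lenY Y⊆ {y} y∈Y = subst (_≤ length (nbrs i y V ∖ Y)) (sym lenY) (+-cancelʳ-≤ m _ _ (begin
        suc m + m                                       ≡⟨ cong (λ l → suc (m + l)) (+-identityʳ m) ⟨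
        suc (2 * m)                                     ≤⟨ proj₂ (proj₂ (∈-filter⁻ (high? i) {xs = V} (Y⊆ y∈Y))) ⟩
        deg i y V                                       ≤⟨ Unique-⊆⇒length≤ (nbrs-unique i y V!) split ⟩
        length ((nbrs i y V ∖ Y) ++ (Y ∖ (y ∷ [])))     ≡⟨ length-++ (nbrs i y V ∖ Y) ⟩
        length (nbrs i y V ∖ Y) + length (Y ∖ (y ∷ [])) ≤⟨ +-monoʳ-≤ (length (nbrs i y V ∖ Y))
                                                             (s≤s⁻¹ (subst (length (Y ∖ (y ∷ [])) <_) lenY (length-∖-self y∈Y))) ⟩
        length (nbrs i y V ∖ Y) + m                     ∎))
        where
        open ≤-Reasoning
        open import Data.List.Membership.DecPropositional (Fin._≟_ {N}) using () renaming (_∈?_ to _∈N?_)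
        split : ∀ {v} → v ∈ nbrs i y V → v ∈ (nbrs i y V ∖ Y) ++ (Y ∖ (y ∷ []))
        split {v} v∈ with v ∈N? Y
        ... | yes v∈Y = ∈-++⁺ʳ (nbrs i y V ∖ Y) (∈-∖⁺ v∈Y λ { (here refl) → proj₁ (proj₂ (∈-nbrs⁻ {V = V} v∈)) refl })
        ... | no v∉Y = ∈-++⁺ˡ (∈-∖⁺ v∈ v∉Y)

      from-class : ∀ i → m < length (class i) → Family C V (suc m)
      from-class i m<class =
        family-mono (λ { (here refl) → i∈C }) (subst (Family (i ∷ []) V) lenY
          (greedy i Y V (Unique.take⁺ (suc m) (Unique.filter⁺ (high? i) V!)) V!
            (λ y∈ → proj₁ (∈-filter⁻ (high? i) {xs = V} (∈-take (suc m) y∈)))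
            (outside lenY (∈-take (suc m)))))
        where
        Y : List (Fin N)
        Y = take (suc m) (class i)
        lenY : length Y ≡ suc m
        lenY = length-take-≤ (class i) m<class
        i∈C : i ∈ C
        -- The class is nonempty, and membership of any vertex in it records `i ∈ C`.
        i∈C = proj₁ (proj₂ (∈-filter⁻ (high? i) {xs = V} (∈-lookup {xs = class i} (Data.Fin.fromℕ< m<class))))

    -- More than 3m vertices are spread over three classes, so some class has at least m + 1
    -- members, and these are matched greedily.
    high-degrees : Family C V (suc m)
    high-degrees with suc m ≤? length (class 0F) | suc m ≤? length (class 1F) | suc m ≤? length (class 2F)
    ... | yes p | _ | _ = from-class 0F p
    ... | _ | yes p | _ = from-class 1F p
    ... | _ | _ | yes p = from-class 2F p
    ... | no p | no q | no r = contradiction (begin-strict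
      3 * m                                                     <⟨ 3m<V ⟩
      length V                                                  ≤⟨ Unique-⊆⇒length≤ V! classified ⟩
      length (class 0F ++ class 1F ++ class 2F)                 ≡⟨ length-++ (class 0F) ⟩
      length (class 0F) + length (class 1F ++ class 2F)         ≡⟨ cong (length (class 0F) +_) (length-++ (class 1F)) ⟩
      length (class 0F) + (length (class 1F) + length (class 2F))
        ≤⟨ +-mono-≤ (≮⇒≥ p) (+-mono-≤ (≮⇒≥ q) (≮⇒≥ r)) ⟩
      m + (m + m)                                               ≡⟨ cong (λ l → m + (m + l)) (+-identityʳ m) ⟨
      3 * m                                                     ∎) (<-irrefl refl)
      where open ≤-Reasoning

  -- Branches around a vertex of large degree in two colours

  record Spoke : Set where
    constructor spoke
    field
      b c   : Fin N
      third : Fin N × Fin N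
      extra : List (Fin N)

  module _ (C : List (Fin 3)) (j k : Fin 3) (x : Fin N) (V : List (Fin N)) where
    open Spoke

    Third : Fin 3 → Set
    Third c = c ∈ C × c ≢ j × c ≢ k

    -- Here `extra` holds the vertex that the edge `third` needs besides `x`, `b` and `c`; it is
    -- empty when only two colours are in play.
    spokeCore : Spoke → List (Fin N)
    spokeCore s = x ∷ b s ∷ c s ∷ extra s

    record SpokeIn (s : Spoke) : Set where
      field
        b∈         : b s ∈ nbrs j x V
        c∈         : c s ∈ nbrs k x V
        extra⊆V    : ∀ {v} → v ∈ extra s → v ∈ V
        third-col  : ∀ {i} → Third i → uncurry col (third s) ≡ i
        third-loop : ∀ {i} → Third i → proj₁ (third s) ≢ proj₂ (third s)
        third-core : ∀ {i} → Third i → proj₁ (third s) ∈ spokeCore s × proj₂ (third s) ∈ spokeCore s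

    record SpokesApart (s s′ : Spoke) : Set where
      field
        b≢     : b s ≢ b s′
        c≢     : c s ≢ c s′
        third≢ : ∀ {i} → Third i → ¬ (third s ≈ᵉ third s′)
          × (Touches (third s) (spokeCore s′) ⊎ Touches (third s′) (spokeCore s))

    data Slot (i : Fin 3) : Set where
      j-slot : i ≡ j → Slot i
      k-slot : i ≡ k → Slot i
      other  : i ≢ j → i ≢ k → Slot i

    slot : ∀ i → Slot i
    slot i with i Fin.≟ j | i Fin.≟ k
    ... | yes i≡j | _ = j-slot i≡j
    ... | no _ | yes i≡k = k-slot i≡k
    ... | no i≢j | no i≢k = other i≢j i≢k

    slotArm : ∀ {i} → Slot i → Spoke → Fin N × Fin N
    slotArm (j-slot _) s = x , b s
    slotArm (k-slot _) s = x , c s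
    slotArm (other _ _) s = third s

    -- The arms of colours `j` and `k` all pass through `x`, which lies in every core, so for these
    -- colours compatibility only asks for different second ends. The edge of the third colour
    -- brings its own condition, `third≢`.
    spokes-branching : ∀ {n} → x ∈ V → (ss : List Spoke) → length ss ≡ suc n →
                       All SpokeIn ss → AllPairs SpokesApart ss →
                       (∀ s → s ∈ ss → Family C (V ∖ spokeCore s) n) → Family C V (suc n)
    spokes-branching {n} x∈V ss len ins apart F =
      branching (All.reduce branch ins) (trans (length-reduce branch ins) len)
        (reduce-pairs branch compat apart ins)
        (λ B B∈ → let s , _ , s∈ , B≡ = ∈-reduce⁻ branch {ps = ins} B∈ in
                  subst (λ B → Family C (V ∖ core B) n) (sym B≡) (F s s∈))
      where
      open SpokeIn
      open SpokesApart
      branch : ∀ {s} → SpokeIn s → Branch C V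
      branch {s} s-in = record
        { core = spokeCore s
        ; arm = λ i → slotArm (slot i) s
        ; core⊆V = λ { (here refl) → x∈V
                     ; (there (here refl)) → proj₁ (∈-nbrs⁻ (b∈ s-in))
                     ; (there (there (here refl))) → proj₁ (∈-nbrs⁻ (c∈ s-in))
                     ; (there (there (there v∈))) → extra⊆V s-in v∈ }
        ; arm-col = λ {i} → col-ok (slot i)
        ; arm-loop = λ {i} → loop-ok (slot i)
        ; arm-core = λ {i} → core-ok (slot i)
        }
        where
        col-ok : ∀ {i} (sl : Slot i) → i ∈ C → uncurry col (slotArm sl s) ≡ i
        col-ok (j-slot refl) _ = proj₂ (proj₂ (∈-nbrs⁻ {V = V} (b∈ s-in)))
        col-ok (k-slot refl) _ = proj₂ (proj₂ (∈-nbrs⁻ {V = V} (c∈ s-in)))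
        col-ok (other p q) i∈ = third-col s-in (i∈ , p , q)
        loop-ok : ∀ {i} (sl : Slot i) → i ∈ C → proj₁ (slotArm sl s) ≢ proj₂ (slotArm sl s)
        loop-ok (j-slot refl) _ = proj₁ (proj₂ (∈-nbrs⁻ {V = V} (b∈ s-in)))
        loop-ok (k-slot refl) _ = proj₁ (proj₂ (∈-nbrs⁻ {V = V} (c∈ s-in)))
        loop-ok (other p q) i∈ = third-loop s-in (i∈ , p , q)
        core-ok : ∀ {i} (sl : Slot i) → i ∈ C →
                  proj₁ (slotArm sl s) ∈ spokeCore s × proj₂ (slotArm sl s) ∈ spokeCore s
        core-ok (j-slot _) _ = here refl , there (here refl)
        core-ok (k-slot _) _ = here refl , there (there (here refl))
        core-ok (other p q) i∈ = third-core s-in (i∈ , p , q)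

      rim≢ : ∀ {v v′} → x ≢ v → v ≢ v′ → ¬ ((x , v) ≈ᵉ (x , v′))
      rim≢ x≢v v≢v′ (inj₁ (_ , v≡v′)) = v≢v′ v≡v′
      rim≢ x≢v v≢v′ (inj₂ (_ , v≡x)) = x≢v (sym v≡x)

      compat : ∀ {s s′} (p : SpokeIn s) (q : SpokeIn s′) → SpokesApart s s′ → Compatible (branch p) (branch q)
      compat {s} {s′} p q ap {i} i∈ with slot i
      ... | j-slot _ = rim≢ (proj₁ (proj₂ (∈-nbrs⁻ {V = V} (b∈ p)))) (b≢ ap) , inj₁ (inj₁ (here refl))
      ... | k-slot _ = rim≢ (proj₁ (proj₂ (∈-nbrs⁻ {V = V} (c∈ p)))) (c≢ ap) , inj₁ (inj₁ (here refl))
      ... | other r t = third≢ ap (i∈ , r , t)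

  open Spoke

  large-summand : ∀ {m a b} → 3 * m < a + b → b ≤ 2 * m → m < a
  large-summand {m} {a} {b} 3m<a+b b≤2m = ≰⇒> λ a≤m → <-irrefl refl (<-≤-trans 3m<a+b (+-mono-≤ a≤m b≤2m))

  pairing : ∀ n (bs cs : List (Fin N)) → Unique bs → Unique cs → n ≤ length bs → n ≤ length cs →
            ∃ λ ps → length ps ≡ n
              × AllPairs (λ p q → proj₁ p ≢ proj₁ q × proj₂ p ≢ proj₂ q) ps
              × All (λ p → proj₁ p ∈ bs × proj₂ p ∈ cs) ps
  pairing zero bs cs bs! cs! _ _ = [] , refl , [] , []
  pairing (suc n) (b ∷ bs) (c ∷ cs) (b∉ ∷ bs!) (c∉ ∷ cs!) (s≤s n≤bs) (s≤s n≤cs)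
    with pairing n bs cs bs! cs! n≤bs n≤cs
  ... | ps , len , apart , ins = (b , c) ∷ ps , cong suc len
    , All.map (λ (b∈ , c∈) → All.lookup b∉ b∈ , All.lookup c∉ c∈) ins ∷ apart
    , (here refl , here refl) ∷ All.map (λ (b∈ , c∈) → there b∈ , there c∈) ins

  two-colour-spokes : ∀ {j k m V x} → Unique V → x ∈ V → m < deg j x V → m < deg k x V →
                      (∀ b c → Family (j ∷ k ∷ []) (V ∖ (x ∷ b ∷ c ∷ [])) m) →
                      Family (j ∷ k ∷ []) V (suc m)
  two-colour-spokes {j} {k} {m} {V} {x} V! x∈V m<dj m<dk F
    with pairing (suc m) (nbrs j x V) (nbrs k x V) (nbrs-unique j x V!) (nbrs-unique k x V!) m<dj m<dk
  ... | ps , len , apart , ins =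
    spokes-branching C j k x V x∈V (map toSpoke ps) (trans (length-map toSpoke ps) len)
      (All.map⁺ (All.map spokeIn ins)) (AllPairs.map⁺ (AllPairs.map spokesApart apart))
      (λ s s∈ → let (b , c) , _ , s≡ = ∈-map⁻ toSpoke s∈ in
                subst (λ s → Family C (V ∖ spokeCore C j k x V s) m) (sym s≡) (F b c))
    where
    C : List (Fin 3)
    C = j ∷ k ∷ []
    no-third : ∀ {i} {A : Set} → Third C j k x V i → A
    no-third (here refl , ≢j , _) = contradiction refl ≢j
    no-third (there (here refl) , _ , ≢k) = contradiction refl ≢k
    -- The third edge is a dummy: no colour of C uses it.
    toSpoke : Fin N × Fin N → Spoke
    toSpoke (b , c) = spoke b c (x , b) []
    spokeIn : ∀ {p} → proj₁ p ∈ nbrs j x V × proj₂ p ∈ nbrs k x V → SpokeIn C j k x V (toSpoke p)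
    spokeIn (b∈ , c∈) = record
      { b∈ = b∈ ; c∈ = c∈ ; extra⊆V = λ ()
      ; third-col = no-third ; third-loop = no-third ; third-core = no-third }
    spokesApart : ∀ {p q} → proj₁ p ≢ proj₁ q × proj₂ p ≢ proj₂ q →
                  SpokesApart C j k x V (toSpoke p) (toSpoke q)
    spokesApart (b≢ , c≢) = record { b≢ = b≢ ; c≢ = c≢ ; third≢ = no-third }

  -- Cores of three vertices suffice here. The bound `h` stays fixed, since deleting vertices never
  -- raises a degree. For n = m + 1, either every vertex has degree above 2m in `j` or `k`, or some
  -- `x` has both degrees at most 2m; their sum exceeds 3m, so each of them exceeds m.
  two-colour : ∀ {i j k} → Cover i j k → ∀ n h V → Unique V → 3 * n + h ≤ suc (length V) →
               (∀ {x} → x ∈ V → deg i x V ≤ h) → Family (j ∷ k ∷ []) V n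
  two-colour cover zero h V V! _ _ = family-zero (here refl)
  two-colour {i} {j} {k} cover (suc m) h V V! size low with All.all? high? V
    where
    high? : ∀ x → Dec (2 * m < deg j x V ⊎ 2 * m < deg k x V)
    high? x = (2 * m <? deg j x V) ⊎-dec (2 * m <? deg k x V)
  ... | yes high = high-degrees (j ∷ k ∷ []) m V V!
          (s≤s⁻¹ (≤-trans (≤-trans (m≤m+n _ (suc h)) (≤-reflexive (arith m h))) size))
          (λ x∈V → [ (λ d → j , here refl , d) , (λ d → k , there (here refl) , d) ]′ (All.lookup high x∈V))
    where
    arith : ∀ m h → suc (suc (3 * m)) + suc h ≡ 3 * suc m + h
    arith = solve-∀
  ... | no ¬high with find (All.¬All⇒Any¬ (λ x → (2 * m <? deg j x V) ⊎-dec (2 * m <? deg k x V)) V ¬high)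
  ...   | x , x∈V , ¬h = two-colour-spokes V! x∈V
            (large-summand sum (≮⇒≥ (¬h ∘ inj₂)))
            (large-summand (subst (3 * m <_) (+-comm (deg j x V) _) sum) (≮⇒≥ (¬h ∘ inj₁)))
            (λ b c → let T = x ∷ b ∷ c ∷ [] in
              two-colour cover m h (V ∖ T) (∖-unique T V!) (smaller T refl)
              (λ {y} y∈ → ≤-trans (deg-∖ i y T V!) (low (proj₁ (∈-∖⁻ V T y∈)))))
    where
    open ≤-Reasoning
    arith : ∀ m h → 2 + h + suc (3 * m) ≡ 3 * suc m + h
    arith = solve-∀
    arith′ : ∀ m h → 3 + (3 * m + h) ≡ 3 * suc m + h
    arith′ = solve-∀
    -- There are at least 3m + 2 + h vertices; `x` and at most `h` neighbours in colour `i` are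
    -- discarded.
    sum : 3 * m < deg j x V + deg k x V
    sum = +-cancelˡ-≤ (2 + h) _ _ (begin
      2 + h + suc (3 * m)                               ≡⟨ arith m h ⟩
      3 * suc m + h                                     ≤⟨ size ⟩
      suc (length V)                                    ≤⟨ s≤s (degree-sum x cover V!) ⟩
      2 + (deg i x V + (deg j x V + deg k x V))         ≤⟨ +-monoʳ-≤ 2 (+-monoˡ-≤ _ (low x∈V)) ⟩
      2 + (h + (deg j x V + deg k x V))                 ∎)
    smaller : ∀ T → length T ≡ 3 → 3 * m + h ≤ suc (length (V ∖ T))
    smaller T len = +-cancelˡ-≤ 3 _ _ (begin
      3 + (3 * m + h)                  ≡⟨ arith′ m h ⟩
      3 * suc m + h                    ≤⟨ size ⟩
      suc (length V)                   ≤⟨ s≤s (length≤∖+ T V!) ⟩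
      suc (length (V ∖ T) + length T)  ≡⟨ cong suc (trans (cong (length (V ∖ T) +_) len) (+-comm _ 3)) ⟩
      3 + suc (length (V ∖ T))         ∎)

  -- Choosing the edges of the third colour

  module _ (x y : Fin N) where

    -- The first alternative belongs to a set {x, y, w, z}, where `w` is `b` or `c`; the second
    -- belongs to a star {x, a, b, c}.
    ThirdFrom : List (Fin N) → List (Fin N) → Spoke → Set
    ThirdFrom W as s =
      (∃ λ w → w ∈ W × third s ≡ (y , w) × extra s ≡ y ∷ [] × w ∈ b s ∷ c s ∷ [])
      ⊎ (∃ λ a → a ∈ as × third s ≡ (x , a) × extra s ≡ a ∷ [])

    SpokeFrom : (bs cs W as : List (Fin N)) → Spoke → Set
    SpokeFrom bs cs W as s = b s ∈ bs × c s ∈ cs × ThirdFrom W as s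

    -- Third edges are compared as ordered pairs at this stage; `thirdsApart` rules out that one is
    -- the reverse of another.
    Differ : Spoke → Spoke → Set
    Differ s s′ = b s ≢ b s′ × c s ≢ c s′ × third s ≢ third s′

    weaken : ∀ {bs bs′ cs cs′ W W′ as as′} →
             (∀ {v} → v ∈ bs → v ∈ bs′) → (∀ {v} → v ∈ cs → v ∈ cs′) →
             (∀ {v} → v ∈ W → v ∈ W′) → (∀ {v} → v ∈ as → v ∈ as′) →
             ∀ {s} → SpokeFrom bs cs W as s → SpokeFrom bs′ cs′ W′ as′ s
    weaken f g h k (b∈ , c∈ , inj₁ (w , w∈ , rest)) = f b∈ , g c∈ , inj₁ (w , h w∈ , rest)
    weaken f g h k (b∈ , c∈ , inj₂ (a , a∈ , rest)) = f b∈ , g c∈ , inj₂ (a , k a∈ , rest)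

    -- A vertex of Wj (of Wk) is adjacent to x in colour j (colour k) and to y in colour i, so it
    -- needs only a partner from cs (from bs); a vertex of as needs a partner from both.
    spokes : ∀ n Wj Wk as bs cs → Unique (Wj ++ bs) → Unique (Wk ++ cs) → Unique (Wj ++ Wk) → Unique as →
             y ≢ x ⊎ Wj ++ Wk ≡ [] →
             length Wj + (length Wk + length as) ≡ n →
             n ≤ length Wj + length bs → n ≤ length Wk + length cs →
             ∃ λ ss → length ss ≡ n × AllPairs Differ ss
               × All (SpokeFrom (Wj ++ bs) (Wk ++ cs) (Wj ++ Wk) as) ss
    spokes zero _ _ _ _ _ _ _ _ _ _ _ _ _ = [] , refl , [] , []
    spokes (suc n) (w ∷ Wj) Wk as bs (z ∷ cs) (w∉ ∷ bs!) cs! (w∉W ∷ W!) as! (inj₁ y≢x) len n≤b n≤c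
      with Unique-mid Wk cs!
    ... | z∉ , cs!′
      with spokes n Wj Wk as bs cs bs! cs!′ W! as! (inj₁ y≢x) (suc-injective len) (s≤s⁻¹ n≤b)
             (s≤s⁻¹ (subst (suc n ≤_) (+-suc (length Wk) (length cs)) n≤c))
    ...   | ss , lenss , differ , from =
      spoke w z (y , w) (y ∷ []) ∷ ss , cong suc lenss
      , All.map (λ { (b∈ , c∈ , t) → All.lookup w∉ b∈ , All.lookup z∉ c∈ , third-differ t }) from ∷ differ
      , (here refl , ∈-++⁺ʳ Wk (here refl) , inj₁ (w , here refl , refl , refl , here refl))
        ∷ All.map (weaken there (∈-mid Wk) there id) from
      where
      third-differ : ∀ {s} → ThirdFrom (Wj ++ Wk) as s → (y , w) ≢ third s
      third-differ (inj₁ (w′ , w′∈ , refl , _)) refl = All.lookup w∉W w′∈ refl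
      third-differ (inj₂ (a , a∈ , refl , _)) refl = y≢x refl
    -- The list `cs` cannot run out here: `Wk` alone would need n + 1 elements, although `w` already
    -- takes one of the n + 1 places.
    spokes (suc n) (w ∷ Wj) Wk as bs [] _ _ _ _ _ len _ n≤c =
      contradiction (begin-strict
        length Wk                               ≤⟨ m≤m+n (length Wk) (length as) ⟩
        length Wk + length as                   ≤⟨ m≤n+m _ (length Wj) ⟩
        length Wj + (length Wk + length as)     <⟨ ≤-reflexive len ⟩
        suc n                                   ≤⟨ n≤c ⟩
        length Wk + 0                           ≡⟨ +-identityʳ _ ⟩
        length Wk                               ∎) (<-irrefl refl)
      where open ≤-Reasoning
    spokes (suc n) [] (w ∷ Wk) as (z ∷ bs) cs (z∉ ∷ bs!) (w∉ ∷ cs!) (w∉W ∷ W!) as! (inj₁ y≢x) len n≤b n≤c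
      with spokes n [] Wk as bs cs bs! cs! W! as! (inj₁ y≢x) (suc-injective len) (s≤s⁻¹ n≤b) (s≤s⁻¹ n≤c)
    ... | ss , lenss , differ , from =
      spoke z w (y , w) (y ∷ []) ∷ ss , cong suc lenss
      , All.map (λ { (b∈ , c∈ , t) → All.lookup z∉ b∈ , All.lookup w∉ c∈ , third-differ t }) from ∷ differ
      , (here refl , here refl , inj₁ (w , here refl , refl , refl , there (here refl)))
        ∷ All.map (weaken there there there id) from
      where
      third-differ : ∀ {s} → ThirdFrom Wk as s → (y , w) ≢ third s
      third-differ (inj₁ (w′ , w′∈ , refl , _)) refl = All.lookup w∉W w′∈ refl
      third-differ (inj₂ (a , a∈ , refl , _)) refl = y≢x refl
    spokes (suc n) [] [] (a ∷ as) (b ∷ bs) (c ∷ cs) (b∉ ∷ bs!) (c∉ ∷ cs!) W! (a∉ ∷ as!) _ len n≤b n≤c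
      with spokes n [] [] as bs cs bs! cs! W! as! (inj₂ refl) (suc-injective len) (s≤s⁻¹ n≤b) (s≤s⁻¹ n≤c)
    ... | ss , lenss , differ , from =
      spoke b c (x , a) (a ∷ []) ∷ ss , cong suc lenss
      , All.map (λ { (b∈ , c∈ , t) → All.lookup b∉ b∈ , All.lookup c∉ c∈ , third-differ t }) from ∷ differ
      , (here refl , here refl , inj₂ (a , here refl , refl , refl))
        ∷ All.map (weaken there there id there) from
      where
      third-differ : ∀ {s} → ThirdFrom [] as s → (x , a) ≢ third s
      third-differ (inj₂ (a′ , a′∈ , refl , _)) refl = All.lookup a∉ a′∈ refl

  module _ {i j k m V x y} (cover : Cover i j k) (V! : Unique V) (x∈V : x ∈ V) (y∈V : y ∈ V)
           (m<dj : m < deg j x V) (m<dk : m < deg k x V)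
           (as : List (Fin N)) (as! : Unique as) (as⊆ : ∀ {a} → a ∈ as → a ∈ nbrs i x V)
           (W : List (Fin N)) (W! : Unique W) (y≢x⊎W≡[] : y ≢ x ⊎ W ≡ [])
           (W⊆ : ∀ {w} → w ∈ W → w ∈ nbrs i y V × x ≢ w × col x w ≢ i)
           (len : length W + length as ≡ suc m) where
    private
      j? : ∀ w → Dec (col x w ≡ j)
      j? w = col x w Fin.≟ j

      Wj Wk bs cs : List (Fin N)
      Wj = filter j? W
      Wk = filter (¬? ∘ j?) W
      -- The list `Wj ++ bs` is the neighbourhood of `x` in colour `j` with the vertices of `Wj`
      -- moved to the front; `Wk ++ cs` does the same for `k`.
      bs = nbrs j x V ∖ Wj
      cs = nbrs k x V ∖ Wk

      ∈-Wj : ∀ {w} → w ∈ Wj → w ∈ W × col x w ≡ j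
      ∈-Wj = ∈-filter⁻ j?
      ∈-Wk : ∀ {w} → w ∈ Wk → w ∈ W × col x w ≢ j
      ∈-Wk = ∈-filter⁻ (¬? ∘ j?)

      Wj++Wk⊆ : ∀ {w} → w ∈ Wj ++ Wk → w ∈ W
      Wj++Wk⊆ w∈ = [ proj₁ ∘ ∈-Wj , proj₁ ∘ ∈-Wk ]′ (∈-++⁻ Wj w∈)

      bs! : Unique (Wj ++ bs)
      bs! = Unique.++⁺ (Unique.filter⁺ j? W!) (∖-unique Wj (nbrs-unique j x V!))
        λ (w∈Wj , w∈bs) → proj₂ (∈-∖⁻ (nbrs j x V) Wj w∈bs) w∈Wj
      cs! : Unique (Wk ++ cs)
      cs! = Unique.++⁺ (Unique.filter⁺ (¬? ∘ j?) W!) (∖-unique Wk (nbrs-unique k x V!))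
        λ (w∈Wk , w∈cs) → proj₂ (∈-∖⁻ (nbrs k x V) Wk w∈cs) w∈Wk
      W′! : Unique (Wj ++ Wk)
      W′! = Unique.++⁺ (Unique.filter⁺ j? W!) (Unique.filter⁺ (¬? ∘ j?) W!)
        λ (w∈Wj , w∈Wk) → proj₂ (∈-Wk w∈Wk) (proj₂ (∈-Wj w∈Wj))

      W′-length : length Wj + length Wk ≡ length W
      W′-length = trans (sym (length-++ Wj))
        (≤-antisym (Unique-⊆⇒length≤ W′! Wj++Wk⊆) (Unique-⊆⇒length≤ W! split))
        where
        split : ∀ {w} → w ∈ W → w ∈ Wj ++ Wk
        split {w} w∈ with j? w
        ... | yes c = ∈-++⁺ˡ (∈-filter⁺ j? w∈ c)
        ... | no ¬c = ∈-++⁺ʳ Wj (∈-filter⁺ (¬? ∘ j?) w∈ ¬c)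

      rest-length : ∀ l W₁ → m < deg l x V → suc m ≤ length W₁ + length (nbrs l x V ∖ W₁)
      rest-length l W₁ m<d = ≤-trans m<d (≤-trans (length≤∖+ W₁ (nbrs-unique l x V!)) (≤-reflexive (+-comm _ (length W₁))))

      b⊆ : ∀ {b} → b ∈ Wj ++ bs → b ∈ nbrs j x V
      b⊆ b∈ with ∈-++⁻ Wj b∈
      ... | inj₁ b∈Wj = let b∈W , c = ∈-Wj b∈Wj ; b∈y , x≢b , _ = W⊆ b∈W in
                        ∈-nbrs⁺ (proj₁ (∈-nbrs⁻ {V = V} b∈y)) x≢b c
      ... | inj₂ b∈bs = proj₁ (∈-∖⁻ (nbrs j x V) Wj b∈bs)

      -- A vertex of `Wk` is joined to `x` neither in colour `i`, by the choice of `W`, nor in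
      -- colour `j`, so colour `k` remains.
      c⊆ : ∀ {c} → c ∈ Wk ++ cs → c ∈ nbrs k x V
      c⊆ {c} c∈ with ∈-++⁻ Wk c∈
      ... | inj₂ c∈cs = proj₁ (∈-∖⁻ (nbrs k x V) Wk c∈cs)
      ... | inj₁ c∈Wk with ∈-Wk c∈Wk
      ...   | c∈W , ≢j with W⊆ c∈W | cover (col x c)
      ...     | _ , _ , ≢i | inj₁ ≡i = contradiction ≡i ≢i
      ...     | _ | inj₂ (inj₁ ≡j) = contradiction ≡j ≢j
      ...     | c∈y , x≢c , _ | inj₂ (inj₂ ≡k) = ∈-nbrs⁺ (proj₁ (∈-nbrs⁻ {V = V} c∈y)) x≢c ≡k

      From : Spoke → Set
      From = SpokeFrom x y (Wj ++ bs) (Wk ++ cs) (Wj ++ Wk) as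

      third-colour : ∀ {l} → Third colours j k x V l → i ≡ l
      third-colour {l} (_ , ≢j , ≢k) with cover l
      ... | inj₁ l≡i = sym l≡i
      ... | inj₂ (inj₁ l≡j) = contradiction l≡j ≢j
      ... | inj₂ (inj₂ l≡k) = contradiction l≡k ≢k

      spokeIn : ∀ {s} → From s → SpokeIn colours j k x V s
      spokeIn {spoke b c _ _} (b∈ , c∈ , inj₁ (w , w∈ , refl , refl , w∈bc)) = record
        { b∈ = b⊆ b∈ ; c∈ = c⊆ c∈
        ; extra⊆V = λ { (here refl) → y∈V }
        ; third-col = λ t → trans (proj₂ (proj₂ (∈-nbrs⁻ {V = V} w∈y))) (third-colour t)
        ; third-loop = λ _ → proj₁ (proj₂ (∈-nbrs⁻ {V = V} w∈y))
        ; third-core = λ _ → there (there (there (here refl))) , there (∈-++⁺ˡ w∈bc)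
        }
        where
        w∈y : w ∈ nbrs i y V
        w∈y = proj₁ (W⊆ (Wj++Wk⊆ w∈))
      spokeIn (b∈ , c∈ , inj₂ (a , a∈ , refl , refl)) = record
        { b∈ = b⊆ b∈ ; c∈ = c⊆ c∈
        ; extra⊆V = λ { (here refl) → proj₁ (∈-nbrs⁻ (as⊆ a∈)) }
        ; third-col = λ t → trans (proj₂ (proj₂ (∈-nbrs⁻ {V = V} (as⊆ a∈)))) (third-colour t)
        ; third-loop = λ _ → proj₁ (proj₂ (∈-nbrs⁻ {V = V} (as⊆ a∈)))
        ; third-core = λ _ → here refl , there (there (there (here refl)))
        }

      -- An edge at `x` meets every core, and two third edges at `y` meet each other's cores in `y`.
      -- If one edge were the reverse of another, then `x` would lie in `W`, or `x` or `y` would be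
      -- its own neighbour.
      thirdsApart : ∀ {s s′} → ThirdFrom x y (Wj ++ Wk) as s → ThirdFrom x y (Wj ++ Wk) as s′ → third s ≢ third s′ →
                    ¬ (third s ≈ᵉ third s′) × (Touches (third s) (spokeCore colours j k x V s′)
                      ⊎ Touches (third s′) (spokeCore colours j k x V s))
      thirdsApart (inj₁ (w , w∈ , refl , refl , _)) (inj₁ (w′ , w′∈ , refl , refl , _)) t≢ =
        (λ { (inj₁ (refl , refl)) → t≢ refl
           ; (inj₂ (refl , _)) → proj₁ (proj₂ (∈-nbrs⁻ {V = V} (proj₁ (W⊆ (Wj++Wk⊆ w′∈))))) refl })
        , inj₁ (inj₁ (there (there (there (here refl)))))
      thirdsApart (inj₁ (w , w∈ , refl , refl , _)) (inj₂ (a , a∈ , refl , refl)) t≢ =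
        (λ { (inj₁ (refl , refl)) → t≢ refl
           ; (inj₂ (_ , refl)) → proj₁ (proj₂ (W⊆ (Wj++Wk⊆ w∈))) refl })
        , inj₂ (inj₁ (here refl))
      thirdsApart (inj₂ (a , a∈ , refl , refl)) (inj₁ (w , w∈ , refl , refl , _)) t≢ =
        (λ { (inj₁ (refl , refl)) → t≢ refl
           ; (inj₂ (refl , _)) → proj₁ (proj₂ (W⊆ (Wj++Wk⊆ w∈))) refl })
        , inj₁ (inj₁ (here refl))
      thirdsApart (inj₂ (a , a∈ , refl , refl)) (inj₂ (a′ , a′∈ , refl , refl)) t≢ =
        (λ { (inj₁ (refl , refl)) → t≢ refl
           ; (inj₂ (refl , _)) → proj₁ (proj₂ (∈-nbrs⁻ {V = V} (as⊆ a′∈))) refl })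
        , inj₁ (inj₁ (here refl))

      spokesApart : ∀ {s s′} → From s × From s′ × Differ x y s s′ → SpokesApart colours j k x V s s′
      spokesApart ((_ , _ , t) , (_ , _ , t′) , b≢ , c≢ , t≢) =
        record { b≢ = b≢ ; c≢ = c≢ ; third≢ = λ _ → thirdsApart t t′ t≢ }

      core-size : ∀ {s} → From s → length (spokeCore colours j k x V s) ≡ 4
      core-size (_ , _ , inj₁ (_ , _ , _ , refl , _)) = refl
      core-size (_ , _ , inj₂ (_ , _ , _ , refl)) = refl

    -- The m + 1 edges of colour `i` are shared between `x`, with second ends `as`, and `y`, with
    -- second ends `W`. Allowing `W` to be empty with `y` equal to `x` covers the case in which `x`
    -- alone has enough neighbours in colour `i`.
    three-colour-spokes : (∀ T → length T ≡ 4 → Family colours (V ∖ T) m) → Family colours V (suc m)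
    three-colour-spokes F
      with spokes x y (suc m) Wj Wk as bs cs bs! cs! W′! as! (Sum.map₂ (λ { refl → refl }) y≢x⊎W≡[])
             (trans (sym (+-assoc (length Wj) _ _)) (trans (cong (_+ length as) W′-length) len))
             (rest-length j Wj m<dj) (rest-length k Wk m<dk)
    ... | ss , lenss , differ , from =
      spokes-branching colours j k x V x∈V ss lenss (All.map spokeIn from)
        (AllPairs.map spokesApart (AllPairs-All from differ))
        (λ s s∈ → F _ (core-size (All.lookup from s∈)))

  -- The induction with all three colours

  both-large : ∀ {i j k m V} x → Unique V → 4 * suc m ≤ 2 + length V → Cover i j k → deg i x V ≤ m →
               (∀ l → deg l x V ≤ 2 * m) → m < deg j x V × m < deg k x V
  both-large {i} {j} {k} {m} {V} x V! size cover di≤m low =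
    large-summand sum (low k) , large-summand (subst (3 * m <_) (+-comm (deg j x V) _) sum) (low j)
    where
    open ≤-Reasoning
    arith : ∀ m → (3 + m) + suc (3 * m) ≡ 4 * suc m
    arith = solve-∀
    -- There are at least 4m + 2 vertices; without `x` and at most m neighbours in colour `i`, at
    -- least 3m + 1 are left.
    sum : 3 * m < deg j x V + deg k x V
    sum = +-cancelˡ-≤ (3 + m) _ _ (begin
      3 + m + suc (3 * m)                          ≡⟨ arith m ⟩
      4 * suc m                                    ≤⟨ size ⟩
      2 + length V                                 ≤⟨ +-monoʳ-≤ 2 (degree-sum x cover V!) ⟩
      3 + (deg i x V + (deg j x V + deg k x V))    ≤⟨ +-monoʳ-≤ 3 (+-monoˡ-≤ _ di≤m) ⟩
      3 + (m + (deg j x V + deg k x V))            ∎)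

  -- By `both-large`, a colour of degree at most m forces the other two above m. So `i` is the first
  -- of the colours 0 and 1 with such a small degree, and colour 2 if there is none; in that case
  -- its own degree may be large as well.
  two-large : ∀ {m V} x → Unique V → 4 * suc m ≤ 2 + length V → (∀ l → deg l x V ≤ 2 * m) →
              ∃ λ i → ∃₂ λ j k → Cover i j k × m < deg j x V × m < deg k x V
  two-large {m} {V} x V! size low with m <? deg 0F x V | m <? deg 1F x V
  ... | no ≮ | _ = 0F , 1F , 2F , cover , both-large x V! size cover (≮⇒≥ ≮) low
    where
    cover : Cover 0F 1F 2F
    cover 0F = inj₁ refl
    cover 1F = inj₂ (inj₁ refl)
    cover 2F = inj₂ (inj₂ refl)
  ... | yes _ | no ≮ = 1F , 0F , 2F , cover , both-large x V! size cover (≮⇒≥ ≮) low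
    where
    cover : Cover 1F 0F 2F
    cover 0F = inj₂ (inj₁ refl)
    cover 1F = inj₁ refl
    cover 2F = inj₂ (inj₂ refl)
  ... | yes m<d₀ | yes m<d₁ = 2F , 0F , 1F , cover , m<d₀ , m<d₁
    where
    cover : Cover 2F 0F 1F
    cover 0F = inj₂ (inj₁ refl)
    cover 1F = inj₂ (inj₂ refl)
    cover 2F = inj₁ refl

  remove-four : ∀ {m V} (T : List (Fin N)) → Unique V → length T ≡ 4 →
                4 * suc m ≤ 2 + length V → 4 * m ≤ 2 + length (V ∖ T)
  remove-four {m} {V} T V! len size = +-cancelˡ-≤ 4 _ _ (begin
    4 + 4 * m                           ≡⟨ *-suc 4 m ⟨
    4 * suc m                           ≤⟨ size ⟩
    2 + length V                        ≤⟨ +-monoʳ-≤ 2 (length≤∖+ T V!) ⟩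
    2 + (length (V ∖ T) + length T)     ≡⟨ cong (2 +_) (trans (cong (length (V ∖ T) +_) len) (+-comm _ 4)) ⟩
    4 + (2 + length (V ∖ T))            ∎)
    where open ≤-Reasoning

  -- If x and y are joined in colour i, then x is lost from the neighbourhood of y, but y itself
  -- lies in the neighbourhood of x without being a neighbour of y.
  new-neighbours : ∀ {i x y V} → Unique V → y ∈ V → y ≢ x →
                   deg i y V ≤ deg i x V + length (nbrs i y V ∖ (x ∷ nbrs i x V))
  new-neighbours {i} {x} {y} {V} V! y∈V y≢x = begin
    deg i y V                                 ≤⟨ Unique-⊆⇒length≤ (nbrs-unique i y V!) split ⟩
    length (map exchange (nbrs i x V) ++ new)     ≡⟨ length-++ (map exchange (nbrs i x V)) ⟩
    length (map exchange (nbrs i x V)) + length new ≡⟨ cong (_+ length new) (length-map exchange (nbrs i x V)) ⟩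
    deg i x V + length new                    ∎
    where
    open ≤-Reasoning
    open import Data.List.Membership.DecPropositional (Fin._≟_ {N}) using (_∈?_)
    new : List (Fin N)
    new = nbrs i y V ∖ (x ∷ nbrs i x V)
    exchange : Fin N → Fin N
    exchange v with v Fin.≟ y
    ... | yes _ = x
    ... | no _ = v
    exchange-y : exchange y ≡ x
    exchange-y with y Fin.≟ y
    ... | yes _ = refl
    ... | no ≢ = contradiction refl ≢
    exchange-≢ : ∀ {v} → y ≢ v → exchange v ≡ v
    exchange-≢ {v} y≢v with v Fin.≟ y
    ... | yes v≡y = contradiction (sym v≡y) y≢v
    ... | no _ = refl
    split : ∀ {v} → v ∈ nbrs i y V → v ∈ map exchange (nbrs i x V) ++ new
    split {v} v∈ with ∈-nbrs⁻ {V = V} v∈ | x Fin.≟ v | v ∈? nbrs i x V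
    ... | _ , y≢x , c | yes refl | _ =
      ∈-++⁺ˡ (subst (_∈ map exchange (nbrs i x V)) exchange-y
        (∈-map⁺ exchange (∈-nbrs⁺ y∈V (y≢x ∘ sym) (trans (col-sym x y) c))))
    ... | _ , y≢v , _ | no _ | yes v∈x =
      ∈-++⁺ˡ (subst (_∈ map exchange (nbrs i x V)) (exchange-≢ y≢v) (∈-map⁺ exchange v∈x))
    ... | _ | no x≢v | no v∉x = ∈-++⁺ʳ (map exchange (nbrs i x V)) (∈-∖⁺ v∈
      λ { (here v≡x) → x≢v (sym v≡x) ; (there v∈x) → v∉x v∈x })

  -- The hypothesis is the size bound 4n - 2 written without subtraction. It is preserved when a
  -- core of four vertices is deleted and `n` drops by one.
  three-colour : ∀ n V → Unique V → 4 * n ≤ 2 + length V → Family colours V n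
  three-colour zero V V! _ = family-zero (∈-colours 0F)
  three-colour (suc m) V V! size with All.all? (λ x → Fin.any? λ i → 2 * m <? deg i x V) V
  ... | yes high = high-degrees colours m V V! (s≤s⁻¹ (s≤s⁻¹ (≤-trans (3+≤4* m) size)))
          (λ x∈V → let i , h = All.lookup high x∈V in i , ∈-colours i , h)
    where
    3+≤4* : ∀ m → 3 + 3 * m ≤ 4 * suc m
    3+≤4* m = ≤-trans (m≤m+n _ (suc m)) (≤-reflexive (arith m))
      where
      arith : ∀ m → 3 + 3 * m + suc m ≡ 4 * suc m
      arith = solve-∀
  ... | no ¬high with find (All.¬All⇒Any¬ (λ x → Fin.any? λ i → 2 * m <? deg i x V) V ¬high)
  ...   | x , x∈V , ¬h with two-large x V! size (λ i → ≮⇒≥ (λ h → ¬h (i , h)))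
  ...     | i , j , k , cover , m<dj , m<dk with m <? deg i x V | Any.any? (λ y → m <? deg i y V) V
  -- Here `x` has m + 1 neighbours in colour `i` itself: all branches are stars, `y` is taken to be
  -- `x`, and `W` is empty.
  ...       | yes m<di | _ =
    three-colour-spokes cover V! x∈V x∈V m<dj m<dk
      (take (suc m) (nbrs i x V)) (Unique.take⁺ (suc m) (nbrs-unique i x V!)) (∈-take (suc m))
      [] [] (inj₂ refl) (λ ()) (length-take-≤ (nbrs i x V) m<di)
      (λ T len → three-colour m (V ∖ T) (∖-unique T V!) (remove-four T V! len size))
  -- Every degree in colour `i` is at most m, so `two-colour` applies with `h` equal to m: its bound
  -- 3(m + 1) + m is one less than 4(m + 1).
  ...       | no m≮di | no ¬any = family-mono (λ {i} _ → ∈-colours i)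
    (two-colour cover (suc m) m V V! (s≤s⁻¹ (≤-trans (≤-reflexive (arith m)) size))
      (λ y∈V → ≮⇒≥ λ m<d → ¬any (lose y∈V m<d)))
    where
    arith : ∀ m → suc (3 * suc m + m) ≡ 4 * suc m
    arith = solve-∀
  -- Each neighbour of `x` in colour `i` gives a star; what is missing to m + 1 is made up from
  -- neighbours of `y`, and `new-neighbours` shows that there are enough.
  ...       | no m≮di | yes any with find any
  ...         | y , y∈V , m<dy =
    three-colour-spokes cover V! x∈V y∈V m<dj m<dk
      (nbrs i x V) (nbrs-unique i x V!) id
      W (Unique.take⁺ (suc m ∸ deg i x V) (∖-unique (x ∷ nbrs i x V) (nbrs-unique i y V!)))
      (inj₁ y≢x) W⊆
      (trans (cong (_+ deg i x V) (length-take-≤ new (m≤n+o⇒m∸n≤o (suc m) (deg i x V)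
        (≤-trans m<dy (new-neighbours V! y∈V y≢x))))) (m∸n+n≡m (m≤n⇒m≤1+n (≮⇒≥ m≮di))))
      (λ T len → three-colour m (V ∖ T) (∖-unique T V!) (remove-four T V! len size))
    where
    new W : List (Fin N)
    new = nbrs i y V ∖ (x ∷ nbrs i x V)
    W = take (suc m ∸ deg i x V) new
    y≢x : y ≢ x
    y≢x refl = m≮di m<dy
    W⊆ : ∀ {w} → w ∈ W → w ∈ nbrs i y V × x ≢ w × col x w ≢ i
    W⊆ w∈ with ∈-∖⁻ (nbrs i y V) (x ∷ nbrs i x V) (∈-take (suc m ∸ deg i x V) w∈)
    ... | w∈y , w∉ = w∈y , (λ { refl → w∉ (here refl) })
      , λ c → w∉ (there (∈-nbrs⁺ (proj₁ (∈-nbrs⁻ {V = V} w∈y)) (λ { refl → w∉ (here refl) }) c))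

-- Matchings and copies of nK₂

open Equivalence using (to; from)

∈ˢ-tabulate : ∀ {N} {P : Fin N → Set} (P? : ∀ v → Dec (P v)) {v} →
              v ∈ˢ Vec.tabulate (does ∘ P?) ⇔ P v
∈ˢ-tabulate {P = P} P? {v} = mk⇔ holds (λ p → Vec.lookup⇒[]= v _
    (trans (Vec.lookup∘tabulate (does ∘ P?) v) (dec-true (P? v) p)))
  where
  holds : v ∈ˢ Vec.tabulate (does ∘ P?) → P v
  holds v∈ with P? v | trans (sym (Vec.lookup∘tabulate (does ∘ P?) v)) (Vec.[]=⇒lookup v∈)
  ... | yes p | _ = p
  ... | no _ | ()

module _ {N : ℕ} where
  open import Data.List.Membership.DecPropositional (Fin._≟_ {N}) using (_∈?_)
  open import Data.List.Membership.DecPropositional (Product.≡-dec (Fin._≟_ {N}) (Fin._≟_ {N}))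
    using () renaming (_∈?_ to _∈ₑ?_)

  joins? : ∀ M (u v : Fin N) → Dec (Joins M u v)
  joins? M u v = ((u , v) ∈ₑ? M) ⊎-dec ((v , u) ∈ₑ? M)

  toSubgraph : Matching N → SubgraphData N
  toSubgraph M = subgraph (Vec.tabulate λ v → does (v ∈? ends M))
                          (Vec.tabulate λ u → Vec.tabulate λ v → does (joins? M u v))

  verts-toSubgraph : ∀ M {v} → v ∈ˢ verts (toSubgraph M) ⇔ v ∈ ends M
  verts-toSubgraph M = ∈ˢ-tabulate (_∈? ends M)

  module _ (M : Matching N) where
    open SubgraphData (toSubgraph M) using (_~_)

    ~-toSubgraph : ∀ {u v} → u ~ v ⇔ Joins M u v
    ~-toSubgraph {u} {v} rewrite Vec.lookup∘tabulate (λ u → Vec.tabulate λ v → does (joins? M u v)) u =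
      ∈ˢ-tabulate (joins? M u)

  toSubgraph-≡⇒SameEdges : ∀ {M M′} → toSubgraph M ≡ toSubgraph M′ → SameEdges M M′
  toSubgraph-≡⇒SameEdges {M} {M′} eq =
    (λ {u} {v} j → to (~-toSubgraph M′) (subst (λ S → SubgraphData._~_ S u v) eq (from (~-toSubgraph M) j))) ,
    (λ {u} {v} j → to (~-toSubgraph M) (subst (λ S → SubgraphData._~_ S u v) (sym eq) (from (~-toSubgraph M′) j)))

  end : Fin 2 → Fin N × Fin N → Fin N
  end 0F = proj₁
  end 1F = proj₂

  EndsInjective : ∀ {n} → (Fin n → Fin N × Fin N) → Set
  EndsInjective g = ∀ {q q′} r r′ → end r (g q) ≡ end r′ (g q′) → q ≡ q′ × r ≡ r′

  ∈-ends-tabulate⁺ : ∀ {n} (g : Fin n → Fin N × Fin N) q r → end r (g q) ∈ ends (tabulate g)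
  ∈-ends-tabulate⁺ g zero 0F = here refl
  ∈-ends-tabulate⁺ g zero 1F = there (here refl)
  ∈-ends-tabulate⁺ g (suc q) r = there (there (∈-ends-tabulate⁺ (g ∘ suc) q r))

  ∈-ends-tabulate⁻ : ∀ {n} (g : Fin n → Fin N × Fin N) {v} → v ∈ ends (tabulate g) →
                     ∃₂ λ q r → end r (g q) ≡ v
  ∈-ends-tabulate⁻ {suc n} g (here refl) = zero , 0F , refl
  ∈-ends-tabulate⁻ {suc n} g (there (here refl)) = zero , 1F , refl
  ∈-ends-tabulate⁻ {suc n} g (there (there v∈)) with ∈-ends-tabulate⁻ (g ∘ suc) v∈
  ... | q , r , eq = suc q , r , eq

  endsInjective⇒Unique : ∀ {n} (g : Fin n → Fin N × Fin N) → EndsInjective g → Unique (ends (tabulate g))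
  endsInjective⇒Unique {zero} g inj = []
  endsInjective⇒Unique {suc n} g inj =
    ((λ eq → case proj₂ (inj {zero} {zero} 0F 1F eq) of λ ()) ∷ fresh 0F) ∷ fresh 1F
    ∷ endsInjective⇒Unique (g ∘ suc) λ r r′ eq → let q≡ , r≡ = inj r r′ eq in Fin.suc-injective q≡ , r≡
    where
    fresh : ∀ r → All (end r (g zero) ≢_) (ends (tabulate (g ∘ suc)))
    fresh r = All.tabulate λ v∈ eq → let q , r′ , eq′ = ∈-ends-tabulate⁻ (g ∘ suc) v∈ in
      case proj₁ (inj {zero} {suc q} r r′ (trans eq (sym eq′))) of λ ()

  Unique⇒endsInjective : ∀ {n} (g : Fin n → Fin N × Fin N) → Unique (ends (tabulate g)) → EndsInjective g
  Unique⇒endsInjective g (_ ∷ _ ∷ g!) {suc q} {suc q′} r r′ eq with Unique⇒endsInjective (g ∘ suc) g! r r′ eq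
  ... | refl , r≡r′ = refl , r≡r′
  Unique⇒endsInjective g _ {zero} {zero} 0F 0F eq = refl , refl
  Unique⇒endsInjective g _ {zero} {zero} 1F 1F eq = refl , refl
  Unique⇒endsInjective g ((u≢v ∷ _) ∷ _) {zero} {zero} 0F 1F eq = contradiction eq u≢v
  Unique⇒endsInjective g ((u≢v ∷ _) ∷ _) {zero} {zero} 1F 0F eq = contradiction (sym eq) u≢v
  Unique⇒endsInjective g ((_ ∷ fresh) ∷ _) {zero} {suc q} 0F r eq =
    contradiction eq (All.lookup fresh (∈-ends-tabulate⁺ (g ∘ suc) q r))
  Unique⇒endsInjective g (_ ∷ fresh ∷ _) {zero} {suc q} 1F r eq =
    contradiction eq (All.lookup fresh (∈-ends-tabulate⁺ (g ∘ suc) q r))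
  Unique⇒endsInjective g ((_ ∷ fresh) ∷ _) {suc q} {zero} r 0F eq =
    contradiction (sym eq) (All.lookup fresh (∈-ends-tabulate⁺ (g ∘ suc) q r))
  Unique⇒endsInjective g (_ ∷ fresh ∷ _) {suc q} {zero} r 1F eq =
    contradiction (sym eq) (All.lookup fresh (∈-ends-tabulate⁺ (g ∘ suc) q r))

  tabulate-isCopy : ∀ {n} (g : Fin n → Fin N × Fin N) → EndsInjective g →
                    IsCopy (n K₂) (toSubgraph (tabulate g))
  tabulate-isCopy {n} g inj = record
    { isSubgraph = record
      { ~-sym = λ a → from ~⇔ (Sum.swap (to ~⇔ a))
      ; ~-irrefl = λ { refl a → loopless (to ~⇔ a) }
      ; ~-incident = λ a → from (verts-toSubgraph M) (proj₁ (Joins⇒ends (to ~⇔ a)))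
      }
    ; φ = φ
    ; φ-injective = φ-injective
    ; φ-image = λ v → mk⇔
        (λ v∈ → let q , r , eq = ∈-ends-tabulate⁻ g (to (verts-toSubgraph M) v∈) in
                combine q r , trans (φ-combine q r) eq)
        (λ { (i , refl) → from (verts-toSubgraph M) (∈-ends-tabulate⁺ g (quotient {n} 2 i) (remainder {n} 2 i)) })
    ; φ-adj = λ i j → mk⇔ (λ (i≢j , q≡) → from ~⇔ (joined i j i≢j q≡))
                          (λ a → adjacent i j (to ~⇔ a))
    }
    where
    M : Matching N
    M = tabulate g
    ~⇔ : ∀ {u v} → SubgraphData._~_ (toSubgraph M) u v ⇔ Joins M u v
    ~⇔ = ~-toSubgraph M
    φ : Fin (n * 2) → Fin N
    φ i = end (remainder {n} 2 i) (g (quotient {n} 2 i))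
    φ-combine : ∀ q r → φ (combine q r) ≡ end r (g q)
    φ-combine q r = cong (λ (q , r) → end r (g q)) (Fin.remQuot-combine {n} q r)
    ext : ∀ {i j} → quotient {n} 2 i ≡ quotient {n} 2 j → remainder {n} 2 i ≡ remainder {n} 2 j → i ≡ j
    ext {i} {j} q≡ r≡ = trans (sym (Fin.combine-remQuot {n} 2 i))
      (trans (cong₂ combine q≡ r≡) (Fin.combine-remQuot {n} 2 j))
    φ-injective : Injective _≡_ _≡_ φ
    φ-injective {i} {j} eq = let q≡ , r≡ = inj (remainder {n} 2 i) (remainder {n} 2 j) eq in ext q≡ r≡
    ∈M : ∀ {u v} → (u , v) ∈ M → ∃ λ q → u ≡ end 0F (g q) × v ≡ end 1F (g q)
    ∈M e∈ with ∈-tabulate⁻ e∈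
    ... | q , eq = q , cong proj₁ eq , cong proj₂ eq
    loopless : ∀ {u} → ¬ Joins M u u
    loopless j with ∈M (Sum.reduce j)
    ... | q , refl , eq with inj {q} {q} 0F 1F eq
    ... | _ , ()
    joined : ∀ i j → i ≢ j → quotient {n} 2 i ≡ quotient {n} 2 j → Joins M (φ i) (φ j)
    joined i j i≢j q≡ with remainder {n} 2 i in ri | remainder {n} 2 j in rj
    ... | 0F | 0F = contradiction (ext q≡ (trans ri (sym rj))) i≢j
    ... | 1F | 1F = contradiction (ext q≡ (trans ri (sym rj))) i≢j
    ... | 0F | 1F rewrite q≡ = inj₁ (∈-tabulate⁺ _)
    ... | 1F | 0F rewrite q≡ = inj₂ (∈-tabulate⁺ _)
    adjacent′ : ∀ i j → (φ i , φ j) ∈ M → i ≢ j × quotient {n} 2 i ≡ quotient {n} 2 j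
    adjacent′ i j e∈ with ∈M e∈
    ... | q , eqᵢ , eqⱼ with inj (remainder {n} 2 i) 0F eqᵢ | inj (remainder {n} 2 j) 1F eqⱼ
    ...   | qᵢ , rᵢ | qⱼ , rⱼ = (λ { refl → case trans (sym rᵢ) rⱼ of λ () }) , trans qᵢ (sym qⱼ)
    adjacent : ∀ i j → Joins M (φ i) (φ j) → i ≢ j × quotient {n} 2 i ≡ quotient {n} 2 j
    adjacent i j (inj₁ e∈) = adjacent′ i j e∈
    adjacent i j (inj₂ e∈) = let j≢i , q≡ = adjacent′ j i e∈ in j≢i ∘ sym , sym q≡

  matching⇒isCopy : ∀ {M} → Unique (ends M) → IsCopy (length M K₂) (toSubgraph M)
  matching⇒isCopy {M} M! = subst (IsCopy (length M K₂) ∘ toSubgraph) (tabulate-lookup M)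
    (tabulate-isCopy (lookup M) (Unique⇒endsInjective (lookup M)
      (subst (Unique ∘ ends) (sym (tabulate-lookup M)) M!)))

  -- Vertex sets and neighbourhoods are bit vectors, so mutual inclusion yields a propositional
  -- equality. Counting copies thereby becomes counting matchings up to `SameEdges`.
  isCopy⇒matching : ∀ {n S} → IsCopy (n K₂) S →
                    ∃ λ M → length M ≡ n × Unique (ends M) × S ≡ toSubgraph M
  isCopy⇒matching {n} {S} copy =
    M , length-tabulate g , endsInjective⇒Unique g g-inj , cong₂ subgraph verts≡ nbhd≡
    where
    open IsCopy copy
    open IsSubgraph isSubgraph
    open SubgraphData S using (_~_; nbhd)
    g : Fin n → Fin N × Fin N
    g q = φ (combine q 0F) , φ (combine q 1F)
    M : Matching N
    M = tabulate g
    end-g : ∀ q r → end r (g q) ≡ φ (combine q r)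
    end-g q 0F = refl
    end-g q 1F = refl
    g-inj : EndsInjective g
    g-inj {q} {q′} r r′ eq =
      Fin.combine-injective q r q′ r′ (φ-injective (trans (sym (end-g q r)) (trans eq (end-g q′ r′))))
    φ-ends : ∀ i → φ i ≡ end (remainder {n} 2 i) (g (quotient {n} 2 i))
    φ-ends i = sym (trans (end-g _ _) (cong φ (Fin.combine-remQuot {n} 2 i)))
    verts≡ : verts S ≡ verts (toSubgraph M)
    verts≡ = Subset.⊆-antisym
      (λ {v} v∈ → let i , eq = to (φ-image v) v∈ in from (verts-toSubgraph M)
        (subst (_∈ ends M) (trans (sym (φ-ends i)) eq) (∈-ends-tabulate⁺ g (quotient {n} 2 i) (remainder {n} 2 i))))
      (λ {v} v∈ → let q , r , eq = ∈-ends-tabulate⁻ g (to (verts-toSubgraph M) v∈) in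
        from (φ-image v) (combine q r , trans (sym (end-g q r)) eq))
    ~⇒Joins : ∀ {u v} → u ~ v → Joins M u v
    ~⇒Joins {u} {v} a with to (φ-image u) (~-incident a) | to (φ-image v) (~-incident (~-sym a))
    ... | i , refl | j , refl with from (φ-adj i j) a
    -- Adjacency passes from `S` back to `n K₂`, and from there to `toSubgraph M`, which is a copy
    -- under the same embedding.
    ... | i≢j , q≡ = to (~-toSubgraph M) (subst₂ (SubgraphData._~_ (toSubgraph M))
                       (sym (φ-ends i)) (sym (φ-ends j)) (to (IsCopy.φ-adj (tabulate-isCopy g g-inj) i j) (i≢j , q≡)))
    matched : ∀ q → φ (combine q 0F) ~ φ (combine q 1F)
    matched q = to (φ-adj _ _)
      ( (λ eq → case proj₂ (Fin.combine-injective q 0F q 1F eq) of λ ())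
      , trans (cong proj₁ (Fin.remQuot-combine q 0F)) (sym (cong proj₁ (Fin.remQuot-combine q 1F))))
    Joins⇒~ : ∀ {u v} → Joins M u v → u ~ v
    Joins⇒~ (inj₁ e∈) with ∈-tabulate⁻ e∈
    ... | q , refl = matched q
    Joins⇒~ (inj₂ e∈) with ∈-tabulate⁻ e∈
    ... | q , refl = ~-sym (matched q)
    nbhd≡ : nbhd ≡ SubgraphData.nbhd (toSubgraph M)
    nbhd≡ = trans (sym (Vec.tabulate∘lookup nbhd)) (Vec.tabulate-cong λ u → Subset.⊆-antisym
      (λ a → from (∈ˢ-tabulate (joins? M u)) (~⇒Joins a))
      (λ a → Joins⇒~ (to (∈ˢ-tabulate (joins? M u)) a)))

-- Counting monochromatic copies

HasCardinality-≤ : ∀ {A : Set} {P Q : A → Set} {a b} → (∀ {x} → P x → Q x) →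
                   HasCardinality P a → HasCardinality Q b → a ≤ b
HasCardinality-≤ P⇒Q (xs , xs! , xs⇔ , refl) (ys , _ , ys⇔ , refl) =
  Unique-⊆⇒length≤ xs! λ x∈ → from (ys⇔ _) (P⇒Q (to (xs⇔ _) x∈))

edge-≡ : ∀ {N} {e f : Edge N} → Edge.lo e ≡ Edge.lo f → Edge.hi e ≡ Edge.hi f → e ≡ f
edge-≡ {e = edge lo hi p} {edge _ _ q} refl refl = cong (edge lo hi) (Fin.<-irrelevant p q)

colourOf : ∀ {N} → Coloring 3 N → Fin N → Fin N → Fin 3
colourOf c u v with Fin.<-cmp u v
... | tri< u<v _ _ = c (edge u v u<v)
-- A default value: the diagonal carries no edge.
... | tri≈ _ _ _ = 0F
... | tri> _ _ v<u = c (edge v u v<u)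

colourOf-sym : ∀ {N} (c : Coloring 3 N) u v → colourOf c u v ≡ colourOf c v u
colourOf-sym c u v with Fin.<-cmp u v | Fin.<-cmp v u
... | tri< p _ _ | tri> _ _ q = cong c (edge-≡ refl refl)
... | tri> _ _ p | tri< q _ _ = cong c (edge-≡ refl refl)
... | tri≈ _ _ _ | tri≈ _ _ _ = refl
... | tri< _ _ ≯ | tri< q _ _ = contradiction q ≯
... | tri< _ ≢ _ | tri≈ _ ≡ _ = contradiction (sym ≡) ≢
... | tri≈ _ ≡ _ | tri< _ ≢ _ = contradiction (sym ≡) ≢
... | tri≈ _ ≡ _ | tri> _ ≢ _ = contradiction (sym ≡) ≢
... | tri> _ ≢ _ | tri≈ _ ≡ _ = contradiction (sym ≡) ≢
... | tri> ≮ _ _ | tri> _ _ q = contradiction q ≮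

colourOf-edge : ∀ {N} (c : Coloring 3 N) e → colourOf c (Edge.lo e) (Edge.hi e) ≡ c e
colourOf-edge c (edge lo hi lo<hi) with Fin.<-cmp lo hi
... | tri< p _ _ = cong c (edge-≡ refl refl)
... | tri≈ ≮ _ _ = contradiction lo<hi ≮
... | tri> ≮ _ _ = contradiction lo<hi ≮

edgeOf : ∀ {N} {u v : Fin N} → u ≢ v → ∃ λ e → (Edge.lo e , Edge.hi e) ≈ᵉ (u , v)
edgeOf {u = u} {v} u≢v with Fin.<-cmp u v
... | tri< u<v _ _ = edge u v u<v , inj₁ (refl , refl)
... | tri≈ _ u≡v _ = contradiction u≡v u≢v
... | tri> _ _ v<u = edge v u v<u , inj₂ (refl , refl)

colourOf-≈ᵉ : ∀ {N} (c : Coloring 3 N) {e : Edge N} {u v} → (Edge.lo e , Edge.hi e) ≈ᵉ (u , v) →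
              colourOf c u v ≡ c e
colourOf-≈ᵉ c {e} (inj₁ (refl , refl)) = colourOf-edge c e
colourOf-≈ᵉ c {e} (inj₂ (refl , refl)) = trans (colourOf-sym c (Edge.hi e) (Edge.lo e)) (colourOf-edge c e)

~-edge : ∀ {N S} {e : Edge N} {u v} → IsSubgraph S → (Edge.lo e , Edge.hi e) ≈ᵉ (u , v) →
         SubgraphData._~_ S u v → e ∈E S
~-edge S (inj₁ (refl , refl)) u~v = u~v
~-edge S (inj₂ (refl , refl)) u~v = IsSubgraph.~-sym S u~v

_≟ˢ_ : ∀ {N} → DecidableEquality (SubgraphData N)
subgraph V E ≟ˢ subgraph V′ E′ = map′ (λ { (refl , refl) → refl }) (λ { refl → refl , refl })
  (Vec.≡-dec Bool._≟_ V V′ ×-dec Vec.≡-dec (Vec.≡-dec Bool._≟_) E E′)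

allLists : ∀ {A : Set} → List A → ℕ → List (List A)
allLists as zero = [] ∷ []
allLists as (suc n) = cartesianProductWith _∷_ as (allLists as n)

∈-allLists : ∀ {A : Set} {as : List A} → (∀ a → a ∈ as) → ∀ xs → xs ∈ allLists as (length xs)
∈-allLists all [] = here refl
∈-allLists all (x ∷ xs) = ∈-cartesianProductWith⁺ _∷_ (all x) (∈-allLists all xs)

module _ {N : ℕ} (c : Coloring 3 N) where
  open Coloured (colourOf c) (colourOf-sym c)
  open import Data.List.Relation.Unary.Unique.DecPropositional (Fin._≟_ {N}) using (unique?)

  Matches : ℕ → Matching N → Set
  Matches = MonoIn colours (allFin N)

  matches? : ∀ n M → Dec (Matches n M)
  matches? n M = map′
    (λ (i , len , M! , colour) → i , ∈-colours i , record
      { size = len ; unique = M! ; within = All.tabulate (λ {v} _ → ∈-allFin v) ; colour = colour })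
    (λ (i , _ , mono) → i , Mono.size mono , Mono.unique mono , Mono.colour mono)
    (Fin.any? λ i → (length M ≟ n) ×-dec (unique? (ends M)
      ×-dec All.all? (λ e → uncurry (colourOf c) e Fin.≟ i) M))

  matches⇒monoCopy : ∀ {n M} → Matches n M → MonoCopy c (n K₂) (toSubgraph M)
  matches⇒monoCopy {M = M} (i , _ , mono) with refl ← Mono.size mono =
    matching⇒isCopy (Mono.unique mono) , λ e f e∈ f∈ → trans (edge-colour e e∈) (sym (edge-colour f f∈))
    where
    edge-colour : ∀ e → e ∈E toSubgraph M → c e ≡ i
    edge-colour e e∈ = trans (sym (colourOf-edge c e)) (Mono.Joins⇒colour mono (to (~-toSubgraph M) e∈))

  monoCopy⇒matches : ∀ {n S} → MonoCopy c (n K₂) S → ∃ λ M → Matches n M × S ≡ toSubgraph M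
  monoCopy⇒matches {n} (copy , mono) with isCopy⇒matching copy
  -- The empty matching is monochromatic in every colour; colour 0 is picked.
  ... | [] , len , M! , refl = [] , (0F , ∈-colours 0F , record
          { size = len ; unique = [] ; within = [] ; colour = [] }) , refl
  ... | M@((u , v) ∷ M′) , len , M! , refl = M , (colourOf c u v , ∈-colours _ , record
          { size = len ; unique = M! ; within = All.tabulate (λ {v} _ → ∈-allFin v)
          ; colour = All.tabulate λ e∈ → same e∈ (here refl) }) , refl
    where
    sub : IsSubgraph (toSubgraph M)
    sub = IsCopy.isSubgraph copy
    find-edge : ∀ {u v} → (u , v) ∈ M → ∃ λ e → e ∈E toSubgraph M × colourOf c u v ≡ c e
    find-edge {u} {v} uv∈ with from (~-toSubgraph M) (inj₁ uv∈)
    ... | u~v with edgeOf {u = u} {v} (λ u≡v → IsSubgraph.~-irrefl sub u≡v u~v)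
    ... | e , e≈ = e , ~-edge {e = e} sub e≈ u~v , colourOf-≈ᵉ c {e} e≈
    same : ∀ {u v u′ v′} → (u , v) ∈ M → (u′ , v′) ∈ M → colourOf c u v ≡ colourOf c u′ v′
    same p q with find-edge p | find-edge q
    ... | e , e∈ , eq | f , f∈ , eq′ = trans eq (trans (mono e f e∈ f∈) (sym eq′))

  -- Every copy arises from a list of `n` ordered pairs, and these lists can be enumerated. Several
  -- lists may give the same copy, hence `deduplicate`.
  monoCopies-finite : ∀ n → ∃ (HasCardinality (MonoCopy c (n K₂)))
  monoCopies-finite n = _ , xs , UniqueDec.deduplicate-! _≟ˢ_ _ , (λ S → mk⇔ sound complete) , refl
    where
    import Data.List.Relation.Unary.Unique.DecPropositional.Properties as UniqueDec
    pairs : List (Fin N × Fin N)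
    pairs = cartesianProduct (allFin N) (allFin N)
    Ms : List (Matching N)
    Ms = filter (matches? n) (allLists pairs n)
    xs : List (SubgraphData N)
    xs = deduplicate _≟ˢ_ (map toSubgraph Ms)
    sound : ∀ {S} → S ∈ xs → MonoCopy c (n K₂) S
    sound S∈ with ∈-map⁻ toSubgraph (∈-deduplicate⁻ _≟ˢ_ (map toSubgraph Ms) S∈)
    ... | M , M∈ , refl = matches⇒monoCopy (proj₂ (∈-filter⁻ (matches? n) {xs = allLists pairs n} M∈))
    complete : ∀ {S} → MonoCopy c (n K₂) S → S ∈ xs
    complete copy with monoCopy⇒matches copy
    ... | M , m@(_ , _ , mono) , refl = ∈-deduplicate⁺ _≟ˢ_ (∈-map⁺ toSubgraph (∈-filter⁺ (matches? n)
            (subst (λ n → M ∈ allLists pairs n) (Mono.size mono)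
              (∈-allLists (λ (u , v) → ∈-cartesianProduct⁺ (∈-allFin u) (∈-allFin v)) M)) m))

  many-monoCopies : ∀ n → 4 * n ≤ 2 + N → ∃ λ Ss → length Ss ≡ n ! × Unique Ss × All (MonoCopy c (n K₂)) Ss
  many-monoCopies n size with three-colour n (allFin N) (Unique.allFin⁺ N)
                                (subst (λ l → 4 * n ≤ 2 + l) (sym (length-tabulate id)) size)
  ... | Ms , len , distinct , good = map toSubgraph Ms , trans (length-map toSubgraph Ms) len
    , AllPairs.map⁺ (AllPairs.map (λ ≄ eq → ≄ (toSubgraph-≡⇒SameEdges eq)) distinct)
    , All.map⁺ (All.map matches⇒monoCopy good)

  n!≤monoCopies : ∀ {n t} → 4 * n ≤ 2 + N → HasCardinality (MonoCopy c (n K₂)) t → n ! ≤ t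
  n!≤monoCopies {n} size (xs , _ , xs⇔ , refl) with many-monoCopies n size
  ... | Ss , len , Ss! , good = subst (_≤ length xs) len
        (Unique-⊆⇒length≤ Ss! λ S∈ → from (xs⇔ _) (All.lookup good S∈))

  monoCopy-exists : ∀ n → 4 * n ≤ 2 + N → ∃ (MonoCopy c (n K₂))
  monoCopy-exists n size with many-monoCopies n size
  ... | [] , len , _ = contradiction len (<⇒≢ (1≤n! n))
  ... | S ∷ _ , _ , _ , good ∷ _ = S , good

-- Minimal and exact colourings

argmin : ∀ {K} → Fin K → (f : Fin K → ℕ) → ∃ λ k → ∀ j → f k ≤ f j
argmin {suc zero} _ f = zero , λ { zero → ≤-refl }
argmin {suc (suc K)} _ f with argmin zero (f ∘ suc)
... | k , min with ≤-total (f zero) (f (suc k))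
...   | inj₁ f0≤ = zero , λ { zero → ≤-refl ; (suc j) → ≤-trans f0≤ (min j) }
...   | inj₂ ≤f0 = suc k , λ { zero → ≤f0 ; (suc j) → min j }

-- Colourings are functions, so minimisation runs over finite codes instead: tables that give a
-- colour to each ordered pair of vertices. Different codes may decode to the same colouring.
decode : ∀ {N} → Fin (3 ^ (N * N)) → Coloring 3 N
decode k e = finToFun k (combine (Edge.lo e) (Edge.hi e))

encode : ∀ {N} → Coloring 3 N → Fin (3 ^ (N * N))
encode {N} c = funToFin λ k → colourOf c (quotient {N} N k) (remainder {N} N k)

decode-encode : ∀ {N} (c : Coloring 3 N) e → decode (encode c) e ≡ c e
decode-encode {N} c e = trans (Fin.finToFun-funToFin {N * N} _ (combine (Edge.lo e) (Edge.hi e)))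
  (trans (cong (uncurry (colourOf c)) (Fin.remQuot-combine {N} (Edge.lo e) (Edge.hi e))) (colourOf-edge c e))

-- Decoding recovers a colouring only pointwise, so copies have to be transported along pointwise
-- equality.
MonoCopy-cong : ∀ {N} {c c′ : Coloring 3 N} {H S} → (∀ e → c e ≡ c′ e) → MonoCopy c H S → MonoCopy c′ H S
MonoCopy-cong c≗c′ (copy , mono) =
  copy , λ e f e∈ f∈ → trans (sym (c≗c′ e)) (trans (mono e f e∈ f∈) (c≗c′ f))

fewest-monoCopies : ∀ N n → ∃ λ M → IsMinimum (λ t → Σ (Coloring 3 N) λ c → HasCardinality (MonoCopy c (n K₂)) t) M
-- The constant colouring serves to show that the set of codes is inhabited, as `argmin` requires.
fewest-monoCopies N n with argmin (encode {N} λ _ → 0F) (λ k → proj₁ (monoCopies-finite (decode {N} k) n))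
... | k , min = _ , (decode k , proj₂ (monoCopies-finite (decode k) n)) , λ t (c , card) →
    ≤-trans (min (encode c)) (HasCardinality-≤ (MonoCopy-cong (decode-encode c))
      (proj₂ (monoCopies-finite (decode (encode c)) n)) card)

_≟ᵉ_ : ∀ {N} → DecidableEquality (Edge N)
e ≟ᵉ f = map′ (λ (p , q) → edge-≡ p q) (λ { refl → refl , refl })
  ((Edge.lo e Fin.≟ Edge.lo f) ×-dec (Edge.hi e Fin.≟ Edge.hi f))

Used : ∀ {N} → Coloring 3 N → Fin 3 → Set
Used c i = ∃ λ e → c e ≡ i

used? : ∀ {N} (c : Coloring 3 N) i → Dec (Used c i)
used? c i = map′ (λ (u , v , u<v , eq) → edge u v u<v , eq) (λ (edge u v u<v , eq) → u , v , u<v , eq)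
  (Fin.any? λ u → Fin.any? λ v → joined? u v)
  where
  joined? : ∀ u v → Dec (∃ λ u<v → c (edge u v u<v) ≡ i)
  joined? u v with u Fin.<? v
  ... | no u≮v = no (u≮v ∘ proj₁)
  ... | yes u<v = map′ (u<v ,_) (λ (u<v′ , eq) → trans (cong c (edge-≡ refl refl)) eq) (c (edge u v u<v) Fin.≟ i)

Refines : ∀ {N} → Graph → Coloring 3 N → Coloring 3 N → Set
Refines H c c′ = (∀ {i} → Used c i → Used c′ i) × (∀ {S} → MonoCopy c′ H S → MonoCopy c H S)

triangle : ∀ {o} → Fin 3 → Edge (3 + o)
triangle 0F = edge 0F 1F (s≤s z≤n)
triangle 1F = edge 0F 2F (s≤s z≤n)
triangle 2F = edge 1F 2F (s≤s (s≤s z≤n))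

triangle-injective : ∀ {o k l} → triangle {o} k ≡ triangle l → k ≡ l
triangle-injective {k = 0F} {0F} _ = refl
triangle-injective {k = 1F} {1F} _ = refl
triangle-injective {k = 2F} {2F} _ = refl
triangle-injective {k = 0F} {1F} ()
triangle-injective {k = 0F} {2F} ()
triangle-injective {k = 1F} {0F} ()
triangle-injective {k = 1F} {2F} ()
triangle-injective {k = 2F} {0F} ()
triangle-injective {k = 2F} {1F} ()

recolour : ∀ {N} → Coloring 3 N → Edge N → Fin 3 → Coloring 3 N
recolour c f i e with e ≟ᵉ f
... | yes _ = i
... | no _ = c e

recolour-same : ∀ {N} (c : Coloring 3 N) f i → recolour c f i f ≡ i
recolour-same c f i with f ≟ᵉ f
... | yes _ = refl
... | no f≢f = contradiction refl f≢f

recolour-other : ∀ {N} (c : Coloring 3 N) {f} i {e} → e ≢ f → recolour c f i e ≡ c e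
recolour-other c {f} i {e} e≢f with e ≟ᵉ f
... | yes e≡f = contradiction e≡f e≢f
... | no _ = refl

-- Give the unused colour i to one of two edges of equal colour: no colour gets lost, and a
-- monochromatic copy through the recoloured edge has no other edge.
use-colour : ∀ {o} H (c : Coloring 3 (3 + o)) (i : Fin 3) → ∃ λ c′ → Refines H c c′ × Used c′ i
use-colour {o} H c i with used? c i
... | yes used = c , (id , id) , used
... | no unused with Fin.pigeonhole ≤-refl (λ k → punchOut (fresh (triangle k)))
  where
  fresh : ∀ e → i ≢ c e
  fresh e i≡ = unused (e , sym i≡)
... | k , l , k<l , clash = recolour c f i , (keeps , λ {S} → mono {S}) , (f , recolour-same c f i)
  where
  f : Edge (3 + o)
  f = triangle k
  ck≡cl : c f ≡ c (triangle l)
  ck≡cl = Fin.punchOut-injective {i = i} (λ i≡ → unused (f , sym i≡)) (λ i≡ → unused (triangle l , sym i≡)) clash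
  keeps : ∀ {j} → Used c j → Used (recolour c f i) j
  keeps (e , refl) with e ≟ᵉ f
  ... | no e≢f = e , recolour-other c i e≢f
  ... | yes refl = triangle l , trans (recolour-other c i λ eq → Fin.<⇒≢ k<l (sym (triangle-injective eq))) (sym ck≡cl)
  mono : ∀ {S} → MonoCopy (recolour c f i) H S → MonoCopy c H S
  mono {S} (copy , same) = copy , same′
    where
    same′ : Monochromatic c S
    same′ e e′ e∈ e′∈ with e ≟ᵉ f | e′ ≟ᵉ f | same e e′ e∈ e′∈
    ... | yes refl | yes refl | _ = refl
    ... | no _ | no _ | eq = eq
    ... | yes refl | no _ | eq = contradiction (e′ , sym eq) unused
    ... | no _ | yes refl | eq = contradiction (e , eq) unused

all-used⇒Exact : ∀ {N} {c : Coloring 3 N} → (∀ i → Used c i) → Exact c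
all-used⇒Exact used i with used i
... | e , eq = e , λ { refl → eq }

exactify : ∀ {o} H (c : Coloring 3 (3 + o)) →
           ∃ λ c′ → Exact c′ × (∀ {S} → MonoCopy c′ H S → MonoCopy c H S)
exactify H c with use-colour H c 0F
... | c₀ , (_ , mono₀) , used₀ with use-colour H c₀ 1F
... | c₁ , (keeps₁ , mono₁) , used₁ with use-colour H c₁ 2F
... | c₂ , (keeps₂ , mono₂) , used₂ = c₂ , exact , λ {S} → mono₀ {S} ∘ mono₁ {S} ∘ mono₂ {S}
  where
  exact : Exact c₂
  exact = all-used⇒Exact λ
    { 0F → keeps₂ (keeps₁ used₀)
    ; 1F → keeps₂ used₁
    ; 2F → used₂ }

-- Four path edges share three colours, so two steps agree in colour. In a rainbow copy they would
-- be the same edge, against the injectivity of `φ`.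
no-rainbow-P₅ : ∀ {N} (c : Coloring 3 N) S → ¬ RainbowCopy c P₅ S
no-rainbow-P₅ {N} c S (copy , rainbow) = same-edge (Fin.pigeonhole ≤-refl (c ∘ step-edge))
  where
  open IsCopy copy
  open SubgraphData S using (_~_)
  step : ∀ (k : Fin 4) → φ (inject₁ k) ~ φ (suc k)
  step k = to (φ-adj (inject₁ k) (suc k)) (inj₁ (cong suc (Fin.toℕ-inject₁ k)))
  stepEdge : ∀ k → ∃ λ e → (Edge.lo e , Edge.hi e) ≈ᵉ (φ (inject₁ k) , φ (suc k))
  stepEdge k = edgeOf λ eq → IsSubgraph.~-irrefl isSubgraph eq (step k)
  step-edge : Fin 4 → Edge N
  step-edge k = proj₁ (stepEdge k)
  step-edge∈ : ∀ k → step-edge k ∈E S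
  step-edge∈ k = ~-edge {e = step-edge k} isSubgraph (proj₂ (stepEdge k)) (step k)
  same-edge : ¬ (∃₂ λ k l → k Data.Fin.< l × c (step-edge k) ≡ c (step-edge l))
  same-edge (k , l , k<l , eq) with rainbow _ _ (step-edge∈ k) (step-edge∈ l) eq
  ... | e≡ with ≈ᵉ-trans (≈ᵉ-sym (proj₂ (stepEdge k)))
                  (subst (λ e → (Edge.lo e , Edge.hi e) ≈ᵉ (φ (inject₁ l) , φ (suc l))) (sym e≡) (proj₂ (stepEdge l)))
  ...   | inj₁ (_ , p) = Fin.<⇒≢ k<l (Fin.suc-injective (φ-injective p))
  -- If the two steps traversed the edge in opposite directions, then k = l + 1, against k < l.
  ...   | inj₂ (p , _) = <⇒≢ (m<n⇒m<1+n k<l) (trans (sym (Fin.toℕ-inject₁ k)) (cong toℕ (φ-injective p)))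

-- Perfect matchings

Unique-resp-↭ : ∀ {A : Set} {xs ys : List A} → xs ↭ ys → Unique xs → Unique ys
Unique-resp-↭ p = Permutation.Unique-resp-↭ (setoid _) (↭⇒↭ₛ p)

-- This is the product of the first `n` odd numbers, the number of perfect matchings on 2n vertices.
oddFactorial : ℕ → ℕ
oddFactorial zero = 1
oddFactorial (suc n) = suc (2 * n) * oddFactorial n

oddFactorial-! : ∀ n → oddFactorial n * (2 ^ n * n !) ≡ (2 * n) !
oddFactorial-! zero = refl
oddFactorial-! (suc n) = begin
  suc (2 * n) * o * (2 * 2 ^ n * (suc n * n !))      ≡⟨ arith n o (2 ^ n) (n !) ⟩
  (2 + 2 * n) * (suc (2 * n) * (o * (2 ^ n * n !)))  ≡⟨ cong (λ x → (2 + 2 * n) * (suc (2 * n) * x)) (oddFactorial-! n) ⟩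
  (2 + 2 * n) * (suc (2 * n) * (2 * n) !)            ≡⟨ cong _! (*-suc 2 n) ⟨
  (2 * suc n) !                                      ∎
  where
  open ≡-Reasoning
  o : ℕ
  o = oddFactorial n
  arith : ∀ n o p f → suc (2 * n) * o * (2 * p * (suc n * f)) ≡ (2 + 2 * n) * (suc (2 * n) * (o * (p * f)))
  arith = solve-∀

module _ {N : ℕ} where

  SameEdges-trans : {M M′ M″ : Matching N} → SameEdges M M′ → SameEdges M′ M″ → SameEdges M M″
  SameEdges-trans (f , f′) (g , g′) = g ∘ f , f′ ∘ g′

  Joins-≈ᵉ : ∀ {M : Matching N} {e f u v} → e ≈ᵉ f → (u , v) ≈ᵉ e → Joins (f ∷ M) u v
  Joins-≈ᵉ e≈f uv≈e with ≈ᵉ-trans uv≈e e≈f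
  ... | inj₁ (refl , refl) = inj₁ (here refl)
  ... | inj₂ (refl , refl) = inj₂ (here refl)

  SameEdges-∷ : ∀ {M M′ : Matching N} {e f} → e ≈ᵉ f → SameEdges M M′ → SameEdges (e ∷ M) (f ∷ M′)
  SameEdges-∷ {M} {M′} e≈f (g , g′) = go e≈f g , go (≈ᵉ-sym e≈f) g′
    where
    go : ∀ {M M′ : Matching N} {e f} → e ≈ᵉ f → (∀ {u v} → Joins M u v → Joins M′ u v) →
         ∀ {u v} → Joins (e ∷ M) u v → Joins (f ∷ M′) u v
    go {M} {e = e} e≈f g j with Joins-∷⁻ {M = M} {e} j
    ... | inj₁ uv≈e = Joins-≈ᵉ e≈f uv≈e
    ... | inj₂ j′ = Joins-∷⁺ (g j′)

  SameEdges-swap : ∀ {M : Matching N} {e f} → SameEdges (e ∷ f ∷ M) (f ∷ e ∷ M)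
  SameEdges-swap = go , go
    where
    go : ∀ {M : Matching N} {e f u v} → Joins (e ∷ f ∷ M) u v → Joins (f ∷ e ∷ M) u v
    go (inj₁ p) = inj₁ (∈-resp-↭ (swap _ _ ↭-refl) p)
    go (inj₂ p) = inj₂ (∈-resp-↭ (swap _ _ ↭-refl) p)

  ends⇒∈ : ∀ {M : Matching N} {v} → v ∈ ends M → ∃ λ e → e ∈ M × v ∈ proj₁ e ∷ proj₂ e ∷ []
  ends⇒∈ {e ∷ M} (here refl) = e , here refl , here refl
  ends⇒∈ {e ∷ M} (there (here refl)) = e , here refl , there (here refl)
  ends⇒∈ {e ∷ M} (there (there v∈)) with ends⇒∈ v∈
  ... | f , f∈ , v∈f = f , there f∈ , v∈f

  ends⇒Joins : ∀ {M : Matching N} {v} → v ∈ ends M → ∃ (Joins M v)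
  ends⇒Joins v∈ with ends⇒∈ v∈
  ... | (_ , w) , e∈ , here refl = w , inj₁ e∈
  ... | (w , _) , e∈ , there (here refl) = w , inj₂ e∈

  SameEdges⇒toSubgraph-≡ : ∀ {M M′ : Matching N} → SameEdges M M′ → toSubgraph M ≡ toSubgraph M′
  SameEdges⇒toSubgraph-≡ {M} {M′} (f , f′) = cong₂ subgraph
    (Subset.⊆-antisym (go {M} {M′} f) (go {M′} {M} f′))
    (Vec.tabulate-cong λ u → Subset.⊆-antisym
      (λ a → from (∈ˢ-tabulate (joins? M′ u)) (f (to (∈ˢ-tabulate (joins? M u)) a)))
      (λ a → from (∈ˢ-tabulate (joins? M u)) (f′ (to (∈ˢ-tabulate (joins? M′ u)) a))))
    where
    go : ∀ {M M′} → (∀ {u v} → Joins M u v → Joins M′ u v) →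
         ∀ {v} → v ∈ˢ verts (toSubgraph M) → v ∈ˢ verts (toSubgraph M′)
    go {M} {M′} f v∈ = from (verts-toSubgraph M′)
      (proj₁ (Joins⇒ends (f (proj₂ (ends⇒Joins (to (verts-toSubgraph M) v∈))))))

  length-ends : ∀ (M : Matching N) → length (ends M) ≡ 2 * length M
  length-ends [] = refl
  length-ends (_ ∷ M) = trans (cong (2 +_) (length-ends M)) (sym (*-suc 2 (length M)))

  -- This adapts a matching to the order of `perfectMatchings`, which treats the first vertex first.
  -- The edge at `v` may sit deep in the list or be stored in reverse, so ends are compared up to
  -- permutation and matchings up to `SameEdges`.
  partner : ∀ (M : Matching N) {v} → v ∈ ends M → ∃₂ λ w M′ →
            ends M ↭ v ∷ w ∷ ends M′ × SameEdges M ((v , w) ∷ M′) × length M ≡ suc (length M′)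
  partner ((u , v) ∷ M) (here refl) = v , M , ↭-refl , (id , id) , refl
  partner ((u , v) ∷ M) (there (here refl)) =
    u , M , swap u v ↭-refl , SameEdges-∷ (inj₂ (refl , refl)) (id , id) , refl
  partner ((u , v) ∷ M) {x} (there (there x∈)) with partner M x∈
  ... | w , M′ , perm , same , len = w , (u , v) ∷ M′
    , ↭-trans (prep u (↭-trans (prep v perm) (swap v x ↭-refl)))
        (↭-trans (swap u x ↭-refl) (prep x (↭-trans (prep u (swap v w ↭-refl)) (swap u w ↭-refl))))
    , SameEdges-trans (SameEdges-∷ (inj₁ (refl , refl)) same) SameEdges-swap
    , cong suc len

  -- The first vertex must be matched to one of the others, and the recursion handles the remaining
  -- ones. The numbers of partners are the odd factors of `oddFactorial`.
  perfectMatchings : ℕ → List (Fin N) → List (Matching N)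
  perfectMatchings zero _ = [] ∷ []
  perfectMatchings (suc n) [] = []
  perfectMatchings (suc n) (v ∷ vs) =
    concatMap (λ w → map ((v , w) ∷_) (perfectMatchings n (vs ∖ (w ∷ [])))) vs

  length-concatMap-≤ : ∀ {A B : Set} (f : A → List B) xs {b} → (∀ {x} → x ∈ xs → length (f x) ≤ b) →
                       length (concatMap f xs) ≤ length xs * b
  length-concatMap-≤ f [] bound = z≤n
  length-concatMap-≤ f (x ∷ xs) bound = ≤-trans (≤-reflexive (length-++ (f x)))
    (+-mono-≤ (bound (here refl)) (length-concatMap-≤ f xs (bound ∘ there)))

  length-perfectMatchings : ∀ n vs → length vs ≤ 2 * n → length (perfectMatchings n vs) ≤ oddFactorial n
  length-perfectMatchings zero vs _ = ≤-refl
  length-perfectMatchings (suc n) [] _ = z≤n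
  length-perfectMatchings (suc n) (v ∷ vs) len = ≤-trans
    (length-concatMap-≤ _ vs λ {w} w∈ → ≤-trans (≤-reflexive (length-map ((v , w) ∷_) (perfectMatchings n (vs ∖ (w ∷ [])))))
      (length-perfectMatchings n (vs ∖ (w ∷ [])) (s≤s⁻¹ (≤-trans (length-∖-self w∈) len′))))
    (*-monoˡ-≤ (oddFactorial n) len′)
    where
    len′ : length vs ≤ suc (2 * n)
    len′ = s≤s⁻¹ (subst (suc (length vs) ≤_) (*-suc 2 n) len)

  perfectMatchings-complete : ∀ n vs (M : Matching N) → length vs ≤ 2 * n → length M ≡ n →
    Unique (ends M) → (∀ {v} → v ∈ ends M → v ∈ vs) →
    ∃ λ M′ → M′ ∈ perfectMatchings n vs × SameEdges M M′
  perfectMatchings-complete zero vs [] _ _ _ _ = [] , here refl , (id , id)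
  perfectMatchings-complete (suc n) [] (_ ∷ _) _ _ _ ⊆vs = case ⊆vs (here refl) of λ ()
  perfectMatchings-complete (suc n) (v ∷ vs) M len lenM M! ⊆vs with v ∈? ends M
    where open import Data.List.Membership.DecPropositional (Fin._≟_ {N}) using (_∈?_)
  -- If `v` were uncovered, the 2n + 2 ends would have to fit into `vs`, which has at most 2n + 1
  -- elements.
  ... | no v∉ = contradiction (begin-strict
      length vs           <⟨ len ⟩
      2 * suc n           ≡⟨ cong (2 *_) lenM ⟨
      2 * length M        ≡⟨ length-ends M ⟨
      length (ends M)     ≤⟨ Unique-⊆⇒length≤ M! (λ w∈ → drop-v w∈ (⊆vs w∈)) ⟩
      length vs           ∎) (<-irrefl refl)
    where
    open ≤-Reasoning
    drop-v : ∀ {w} → w ∈ ends M → w ∈ v ∷ vs → w ∈ vs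
    drop-v w∈ (here refl) = contradiction w∈ v∉
    drop-v w∈ (there w∈vs) = w∈vs
  ... | yes v∈ with partner M v∈
  ...   | w , M₁ , perm , same , lenM₁ with Unique-resp-↭ perm M!
  ...     | (v≢w ∷ v∉) ∷ w∉ ∷ M₁! = finish
    where
    in-vs : ∀ {u} → v ≢ u → u ∈ v ∷ w ∷ ends M₁ → u ∈ vs
    in-vs v≢u u∈ with ⊆vs (∈-resp-↭ (↭-sym perm) u∈)
    ... | here u≡v = contradiction (sym u≡v) v≢u
    ... | there u∈vs = u∈vs
    w∈vs : w ∈ vs
    w∈vs = in-vs v≢w (there (here refl))
    M₁⊆ : ∀ {u} → u ∈ ends M₁ → u ∈ vs ∖ (w ∷ [])
    M₁⊆ u∈ = ∈-∖⁺ (in-vs (All.lookup v∉ u∈) (there (there u∈)))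
      λ { (here refl) → All.lookup w∉ u∈ refl }
    len′ : length (vs ∖ (w ∷ [])) ≤ 2 * n
    len′ = s≤s⁻¹ (≤-trans (length-∖-self w∈vs) (s≤s⁻¹ (subst (suc (length vs) ≤_) (*-suc 2 n) len)))
    finish : ∃ λ M′ → M′ ∈ perfectMatchings (suc n) (v ∷ vs) × SameEdges M M′
    finish with perfectMatchings-complete n (vs ∖ (w ∷ [])) M₁ len′ (suc-injective (trans (sym lenM₁) lenM)) M₁! M₁⊆
    ... | M′ , M′∈ , same′ = (v , w) ∷ M′
      , ∈-concatMap⁺ _ (lose w∈vs (∈-map⁺ ((v , w) ∷_) M′∈))
      , SameEdges-trans same (SameEdges-∷ (inj₁ (refl , refl)) same′)

-- Extremal colourings

band : ℕ → ℕ → ℕ → Fin 3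
band a m v with v <? a | v <? a + m
... | yes _ | _ = 0F
... | no _ | yes _ = 1F
... | no _ | no _ = 2F

band-0 : ∀ a m v → band a m v ≡ 0F ⇔ v < a
band-0 a m v with v <? a | v <? a + m
... | yes v<a | _ = mk⇔ (λ _ → v<a) (λ _ → refl)
... | no v≮a | yes _ = mk⇔ (λ ()) (λ v<a → contradiction v<a v≮a)
... | no v≮a | no _ = mk⇔ (λ ()) (λ v<a → contradiction v<a v≮a)

band-1 : ∀ a m v → band a m v ≡ 1F ⇔ (a ≤ v × v < a + m)
band-1 a m v with v <? a | v <? a + m
... | yes v<a | _ = mk⇔ (λ ()) (λ (a≤v , _) → contradiction v<a (≤⇒≯ a≤v))
... | no v≮a | yes v<a+m = mk⇔ (λ _ → ≮⇒≥ v≮a , v<a+m) (λ _ → refl)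
... | no _ | no v≮a+m = mk⇔ (λ ()) (λ (_ , v<a+m) → contradiction v<a+m v≮a+m)

band-2 : ∀ a m v → band a m v ≡ 2F ⇔ a + m ≤ v
band-2 a m v with v <? a | v <? a + m
... | yes v<a | _ = mk⇔ (λ ()) (λ a+m≤v → contradiction (≤-trans (m≤m+n a m) a+m≤v) (<⇒≱ v<a))
... | no _ | yes v<a+m = mk⇔ (λ ()) (λ a+m≤v → contradiction v<a+m (≤⇒≯ a+m≤v))
... | no _ | no v≮a+m = mk⇔ (λ _ → ≮⇒≥ v≮a+m) (λ _ → refl)

-- Only the upper end decides the colour, so a monochromatic matching has its distinct upper ends in
-- a single band. With m = n - 1, the width `a` is 2n for bounding the multiplicity and 2n - 1 for
-- avoiding copies altogether.
banded : ∀ {N} → ℕ → ℕ → Coloring 3 N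
banded a m e = band a m (toℕ (Edge.hi e))

edgeTo : ∀ {N b} → 0 < b → b < N → ∃ λ (e : Edge N) → toℕ (Edge.hi e) ≡ b
edgeTo {suc N} {suc b} _ b<N = edge zero (Data.Fin.fromℕ< b<N) (s≤s z≤n) , Fin.toℕ-fromℕ< b<N

banded-exact : ∀ {N} a m → 1 < a → 0 < m → a + m < N → Exact (banded {N} a m)
banded-exact {N} a m 1<a 0<m a+m<N = all-used⇒Exact λ
  -- Vertex 0 is never an upper end, so vertex 1 represents the first band; the other two bands use
  -- their least vertices.
  { 0F → used-by 1 (s≤s z≤n) (≤-<-trans (<⇒≤ 1<a) a<N) (from (band-0 a m 1) 1<a)
  ; 1F → used-by a (<⇒≤ 1<a) a<N (from (band-1 a m a) (≤-refl , m<m+n a 0<m))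
  ; 2F → used-by (a + m) (≤-trans (<⇒≤ 1<a) (m≤m+n a m)) a+m<N (from (band-2 a m (a + m)) ≤-refl) }
  where
  a<N : a < N
  a<N = ≤-<-trans (m≤m+n a m) a+m<N
  used-by : ∀ b {i} → 0 < b → b < N → band a m b ≡ i → Used (banded {N} a m) i
  used-by b 0<b b<N eq with edgeTo 0<b b<N
  ... | e , hi≡ = e , trans (cong (band a m) hi≡) eq

interval-length : ∀ {N a m} {vs : List (Fin N)} → Unique vs →
                  (∀ {v} → v ∈ vs → a ≤ toℕ v × toℕ v < a + m) → length vs ≤ m
interval-length {a = a} {m} {vs} vs! bounds = begin
  length vs                    ≡⟨ length-map toℕ vs ⟨
  length (map toℕ vs)          ≤⟨ Unique-⊆⇒length≤ (Unique.map⁺ Fin.toℕ-injective vs!) sub ⟩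
  length (applyUpTo (a +_) m)  ≡⟨ length-applyUpTo (a +_) m ⟩
  m                            ∎
  where
  open ≤-Reasoning
  sub : ∀ {t} → t ∈ map toℕ vs → t ∈ applyUpTo (a +_) m
  sub t∈ with ∈-map⁻ toℕ t∈
  ... | v , v∈ , refl with bounds v∈
  ... | a≤v , v<a+m = subst (_∈ applyUpTo (a +_) m) (m+[n∸m]≡n a≤v)
    (∈-applyUpTo⁺ (a +_) (+-cancelˡ-< a _ _ (subst (_< a + m) (sym (m+[n∸m]≡n a≤v)) v<a+m)))

module _ {N : ℕ} where

  top : Fin N × Fin N → Fin N
  top (u , v) with Fin.<-cmp u v
  ... | tri< _ _ _ = v
  ... | tri≈ _ _ _ = v
  ... | tri> _ _ _ = u

  top-∈ : ∀ u v → top (u , v) ∈ u ∷ v ∷ []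
  top-∈ u v with Fin.<-cmp u v
  ... | tri< _ _ _ = there (here refl)
  ... | tri≈ _ _ _ = there (here refl)
  ... | tri> _ _ _ = here refl

  ≤-top : ∀ u v {w} → w ∈ u ∷ v ∷ [] → toℕ w ≤ toℕ (top (u , v))
  ≤-top u v w∈ with Fin.<-cmp u v | w∈
  ... | tri< u<v _ _ | here refl = <⇒≤ u<v
  ... | tri< _ _ _ | there (here refl) = ≤-refl
  ... | tri≈ _ refl _ | here refl = ≤-refl
  ... | tri≈ _ _ _ | there (here refl) = ≤-refl
  ... | tri> _ _ _ | here refl = ≤-refl
  ... | tri> _ _ v<u | there (here refl) = <⇒≤ v<u

  colour-top : ∀ a m {u v} → u ≢ v → colourOf (banded a m) u v ≡ band a m (toℕ (top (u , v)))
  colour-top a m {u} {v} u≢v with Fin.<-cmp u v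
  ... | tri< _ _ _ = refl
  ... | tri≈ _ u≡v _ = contradiction u≡v u≢v
  ... | tri> _ _ _ = refl

  tops-unique : ∀ {M : Matching N} → Unique (ends M) → Unique (map top M)
  tops-unique {[]} [] = []
  tops-unique {(u , v) ∷ M} ((_ ∷ u∉) ∷ v∉ ∷ M!) = All.tabulate fresh ∷ tops-unique M!
    where
    top-ends : ∀ {t} → t ∈ map top M → t ∈ ends M
    top-ends t∈ with ∈-map⁻ top t∈
    ... | (u′ , v′) , e∈ , refl with top-∈ u′ v′
    ...   | here eq = subst (_∈ ends M) (sym eq) (proj₁ (∈⇒ends e∈))
    ...   | there (here eq) = subst (_∈ ends M) (sym eq) (proj₂ (∈⇒ends e∈))
    fresh : ∀ {t} → t ∈ map top M → top (u , v) ≢ t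
    fresh t∈ refl with top-∈ u v
    ... | here eq = All.lookup u∉ (top-ends t∈) (sym eq)
    ... | there (here eq) = All.lookup v∉ (top-ends t∈) (sym eq)

  Unique-ends⇒loopless : ∀ {M : Matching N} {u v} → Unique (ends M) → (u , v) ∈ M → u ≢ v
  Unique-ends⇒loopless ((u≢v ∷ _) ∷ _) (here refl) = u≢v
  Unique-ends⇒loopless (_ ∷ _ ∷ M!) (there e∈) = Unique-ends⇒loopless M! e∈

  module _ (a m : ℕ) where
    open Coloured (colourOf {N} (banded a m)) (colourOf-sym (banded a m))

    tops-colour : ∀ {i V n M} → Mono i V n M → ∀ {t} → t ∈ map top M → band a m (toℕ t) ≡ i
    tops-colour mono t∈ with ∈-map⁻ top t∈
    ... | _ , e∈ , refl = trans (sym (colour-top a m (Unique-ends⇒loopless (Mono.unique mono) e∈)))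
                                (All.lookup (Mono.colour mono) e∈)

    -- Every edge of colour 1 or 2 has its upper end in a band of only m vertices.
    mono⇒low : N ≤ a + m + m → ∀ {i V M} → Mono i V (suc m) M → ∀ {v} → v ∈ ends M → toℕ v < a
    mono⇒low N≤ {0F} mono v∈ with ends⇒∈ v∈
    ... | (u , w) , e∈ , v∈e = ≤-<-trans (≤-top u w v∈e)
          (to (band-0 a m (toℕ (top (u , w)))) (tops-colour mono (∈-map⁺ top e∈)))
    mono⇒low N≤ {1F} {M = M} mono v∈ = contradiction (subst (_≤ m) (trans (length-map top M) (Mono.size mono))
      (interval-length (tops-unique (Mono.unique mono)) λ {t} t∈ → to (band-1 a m (toℕ t)) (tops-colour mono t∈))) (<⇒≱ ≤-refl)
    mono⇒low N≤ {2F} {M = M} mono v∈ = contradiction (subst (_≤ m) (trans (length-map top M) (Mono.size mono))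
      (interval-length {a = a + m} (tops-unique (Mono.unique mono)) λ {t} t∈ →
        to (band-2 a m (toℕ t)) (tops-colour mono t∈) , <-≤-trans (Fin.toℕ<n t) N≤)) (<⇒≱ ≤-refl)

-- By `mono⇒low`, the 2m + 2 ends of a copy would all lie in the first band, which has at most 2m +
-- 1 vertices.
no-monoCopy : ∀ {N} m → N ≤ 1 + 4 * m → ∀ S → ¬ MonoCopy (banded {N} (suc (2 * m)) m) (suc m K₂) S
no-monoCopy {N} m N≤ S copy with monoCopy⇒matches _ copy
... | M , (i , _ , mono) , _ = <⇒≱ ≤-refl (begin
  2 + 2 * m        ≡⟨ *-suc 2 m ⟨
  2 * suc m        ≡⟨ cong (2 *_) (Coloured.Mono.size mono) ⟨
  2 * length M     ≡⟨ length-ends M ⟨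
  length (ends M)  ≤⟨ interval-length {a = 0} (Coloured.Mono.unique mono) (λ v∈ → z≤n ,
                        mono⇒low (suc (2 * m)) m (≤-trans N≤ (≤-reflexive (arith m))) mono v∈) ⟩
  1 + 2 * m        ∎)
  where
  open ≤-Reasoning
  arith : ∀ m → 1 + 4 * m ≡ suc (2 * m) + m + m
  arith = solve-∀

-- By `mono⇒low`, the 2m + 2 ends of a copy lie among the first 2m + 2 vertices, so the copy appears
-- in the list of their perfect matchings.
few-monoCopies : ∀ {N t} m → N ≤ 2 + 4 * m → HasCardinality (MonoCopy (banded {N} (2 * suc m) m) (suc m K₂)) t →
                 t ≤ oddFactorial (suc m)
few-monoCopies {N} m N≤ (xs , xs! , xs⇔ , refl) = begin
  length xs                                                  ≤⟨ Unique-⊆⇒length≤ xs! (λ S∈ → listed (to (xs⇔ _) S∈)) ⟩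
  length (map toSubgraph (perfectMatchings (suc m) low))     ≡⟨ length-map toSubgraph (perfectMatchings (suc m) low) ⟩
  length (perfectMatchings (suc m) low)                      ≤⟨ length-perfectMatchings (suc m) low low-length ⟩
  oddFactorial (suc m)                                       ∎
  where
  open ≤-Reasoning
  low? : ∀ (v : Fin N) → Dec (toℕ v < 2 * suc m)
  low? v = toℕ v <? 2 * suc m
  low : List (Fin N)
  low = filter low? (allFin N)
  low-length : length low ≤ 2 * suc m
  low-length = interval-length {a = 0} (Unique.filter⁺ low? (Unique.allFin⁺ N))
    λ v∈ → z≤n , proj₂ (∈-filter⁻ low? {xs = allFin N} v∈)
  arith : ∀ m → 2 + 4 * m ≡ 2 * suc m + m + m
  arith = solve-∀
  listed : ∀ {S} → MonoCopy (banded {N} (2 * suc m) m) (suc m K₂) S →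
           S ∈ map toSubgraph (perfectMatchings (suc m) low)
  listed copy with monoCopy⇒matches _ copy
  ... | M , (i , _ , mono) , refl
    with perfectMatchings-complete (suc m) low M low-length (Coloured.Mono.size mono) (Coloured.Mono.unique mono)
           (λ v∈ → ∈-filter⁺ low? (∈-allFin _) (mono⇒low (2 * suc m) m (≤-trans N≤ (≤-reflexive (arith m))) mono v∈))
  ...   | M′ , M′∈ , same = subst (_∈ map toSubgraph (perfectMatchings (suc m) low))
            (sym (SameEdges⇒toSubgraph-≡ same)) (∈-map⁺ toSubgraph M′∈)

-- Ramsey numbers and multiplicities

3≤choose-2 : ∀ m → 3 ≤ m → 3 ≤ suc m choose 2
3≤choose-2 m 3≤m = begin
  3               ≤⟨ 3≤m ⟩
  m               ≡⟨ nC1≡n m ⟨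
  m choose 1           ≤⟨ m≤m+n (m choose 1) (m choose 2) ⟩
  m choose 1 + m choose 2   ≡⟨ nCk+nC[k+1]≡[n+1]C[k+1] m 1 ⟩
  suc m choose 2       ∎
  where open ≤-Reasoning

4*suc≡ : ∀ m → 4 * suc m ≡ 2 + (2 + 4 * m)
4*suc≡ m = *-suc 4 m

ramseyNumber : ∀ m → IsRamseyNumber 3 (suc m K₂) (2 + 4 * m)
ramseyNumber m = (λ c → monoCopy-exists c (suc m) (≤-reflexive (4*suc≡ m))) , λ r copies →
  ≮⇒≥ λ r<N → let S , copy = copies (banded (suc (2 * m)) m) in no-monoCopy m (s≤s⁻¹ r<N) S copy

gallaiRamseyNumber : ∀ k → let m = suc k in IsGallaiRamseyNumber 3 P₅ (suc m K₂) (2 + 4 * m)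
gallaiRamseyNumber k = (3≤choose-2 (1 + 4 * m) (s≤s (≤-trans (m≤m+n 2 2) (*-monoʳ-≤ 4 (s≤s z≤n)))) , λ N N≥ c _ →
    inj₂ (monoCopy-exists c (suc m) (≤-trans (≤-reflexive (4*suc≡ m)) (+-monoʳ-≤ 2 N≥)))) ,
  λ r (_ , copies) → ≮⇒≥ λ r<N →
    [ (λ (S , copy) → no-rainbow-P₅ (extremal {1 + 4 * m}) S copy)
    , (λ (S , copy) → no-monoCopy m ≤-refl S copy) ]′
    -- The property assumed of `r` is applied at order 4m + 1, where all bands are nonempty and the
    -- banded colouring is exact; at order `r` it need not be.
    (copies (1 + 4 * m) (s≤s⁻¹ r<N) extremal
      (banded-exact (suc (2 * m)) m (s≤s (s≤s z≤n)) (s≤s z≤n) (below k)))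
  where
  m : ℕ
  m = suc k
  extremal : ∀ {N} → Coloring 3 N
  extremal = banded (suc (2 * m)) m
  below : ∀ k → suc (2 * suc k) + suc k < 1 + 4 * suc k
  below k = ≤-trans (m≤m+n _ k) (≤-reflexive (arith k))
    where
    arith : ∀ k → suc (suc (2 * suc k) + suc k) + k ≡ 1 + 4 * suc k
    arith = solve-∀

oddFactorial-quotient : ∀ n → oddFactorial n ≡ ((2 * n) ! / (2 ^ n * n !)) {{2^n*n!≢0 n}}
oddFactorial-quotient n = trans (sym (m*n/n≡m (oddFactorial n) (2 ^ n * n !) {{2^n*n!≢0 n}}))
  (cong (λ x → (x / (2 ^ n * n !)) {{2^n*n!≢0 n}}) (oddFactorial-! n))

module _ (k : ℕ) where
  private
    m n N : ℕ
    m = suc k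
    n = suc m
    N = 2 + 4 * m

  -- No colouring has a rainbow path, so both multiplicities minimise the number of monochromatic
  -- copies, one of them over exact colourings only. The exact `c′` attains the minimum `M`: its
  -- copies are among those of the optimal `c`, and minimality gives the other inequality. The upper
  -- bound comes from the banded colouring.
  multiplicities :
    ∀ {M t t₀} (c c′ : Coloring 3 N) → HasCardinality (MonoCopy c (n K₂)) M →
    (∀ t → (Σ (Coloring 3 N) λ c → HasCardinality (MonoCopy c (n K₂)) t) → M ≤ t) →
    Exact c′ → (∀ {S} → MonoCopy c′ (n K₂) S → MonoCopy c (n K₂) S) → HasCardinality (MonoCopy c′ (n K₂)) t →
    HasCardinality (MonoCopy (banded {N} (2 * n) m) (n K₂)) t₀ →
    IsGallaiRamseyMultiplicity 3 P₅ (n K₂) M × IsRamseyMultiplicity 3 (n K₂) M × n ! ≤ M × M ≤ oddFactorial n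
  multiplicities {M} {t} {t₀} c c′ card min exact mono card′ card₀ =
      (N , gallaiRamseyNumber k
      , (c′ , exact , 0 , M , no-copies , subst (HasCardinality (MonoCopy c′ (n K₂))) t≡M card′ , refl)
      , λ { _ (c″ , _ , a , b , _ , card″ , refl) → ≤-trans (min b (c″ , card″)) (m≤n+m b a) })
    , (N , ramseyNumber m , (c , card) , min)
    , n!≤monoCopies c {n} (≤-reflexive (4*suc≡ m)) card
    , ≤-trans (min t₀ (banded {N} (2 * n) m , card₀)) (few-monoCopies m ≤-refl card₀)
    where
    t≡M : t ≡ M
    t≡M = ≤-antisym (HasCardinality-≤ (λ {S} → mono {S}) card′ card) (min t (c′ , card′))
    no-copies : HasCardinality (RainbowCopy c′ P₅) 0
    no-copies = [] , [] , (λ S → mk⇔ (λ ()) (λ copy → contradiction copy (no-rainbow-P₅ c′ S))) , refl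

  multiplicities-exist : ∃ λ M →
    IsGallaiRamseyMultiplicity 3 P₅ (n K₂) M × IsRamseyMultiplicity 3 (n K₂) M × n ! ≤ M × M ≤ oddFactorial n
  multiplicities-exist =
    let M , (c , card) , min = fewest-monoCopies N n
        c′ , exact , mono = exactify (n K₂) c
        t , card′ = monoCopies-finite c′ n
        t₀ , card₀ = monoCopies-finite (banded {N} (2 * n) m) n
    in M , multiplicities c c′ card min exact (λ {S} → mono {S}) card′ card₀

theorem3p6 : (n : ℕ) → 2 ≤ n → ∃₂ λ GM M →
    IsGallaiRamseyMultiplicity 3 P₅ (n K₂) GM ×
    IsRamseyMultiplicity 3 (n K₂) M ×
    n ! ≤ GM × GM ≡ M × M ≤ ((2 * n) ! / (2 ^ n * n !)) {{2^n*n!≢0 n}}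
theorem3p6 (suc (suc k)) _ =
  let M , gallaiRamsey , ramsey , lower , upper = multiplicities-exist k
  in M , M , gallaiRamsey , ramsey , lower , refl ,
     ≤-trans upper (≤-reflexive (oddFactorial-quotient (2 + k)))
theorem3p6 (suc zero) (s≤s ())
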